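{- Let $F$ be a forest with no isolated vertices and with at most one vertex of degree $2$, and let $n_1$ denote the number of vertices of degree one in $F$. Then \[ tvs(F)=\left\lceil \tfrac{n_1+1}{2} \right\rceil. \]
   Context: All graphs are finite, simple and undirected. A total weighting of a graph $G$ with labels in $\{1,\dots,s\}$ is a map $w: V(G)\cup E(G)\to\{1,2,\dots,s\}$. The weighted degree of a vertex $v$ is $wt_G(v)=w(v)+\sum_{e\in E(G),\, v\in e} w(e)$. The weighting is irregular if $wt_G(u)\neq wt_G(v)$ for every pair of distinct vertices $u,v$. The total vertex irregularity strength $tvs(G)$ is the smallest integer $s$ such that $G$ admits an irregular total weighting with labels in $\{1,2,\dots,s\}$. -}

module Defs where

open import Data.Nat using (ℕ; zero; suc; _+_; _≤_; _≡ᵇ_; ⌈_/2⌉)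
open import Data.Fin using (Fin; zero; suc)
open import Data.Bool using (Bool; true; false; if_then_else_)
open import Data.List using (List; _∷_; _∷ʳ_; length)
open import Data.List.Relation.Unary.Linked using (Linked)
open import Data.List.Relation.Unary.Unique.Propositional using (Unique)
open import Data.Product using (Σ; _×_)
open import Relation.Binary.PropositionalEquality using (_≡_; _≢_)
open import Relation.Nullary using (¬_)

∑ : ∀ {n} → (Fin n → ℕ) → ℕ
∑ {zero}  f = 0
∑ {suc n} f = f zero + ∑ (λ i → f (suc i))

record Graph : Set where
  field
    n      : ℕ
    adj    : Fin n → Fin n → Bool
    sym    : ∀ u v → adj u v ≡ adj v u
    irrefl : ∀ v → adj v v ≡ false
open Graph public

Adj : (G : Graph) → Fin (n G) → Fin (n G) → Set
Adj G u v = adj G u v ≡ true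

deg : (G : Graph) → Fin (n G) → ℕ
deg G v = ∑ (λ u → if adj G v u then 1 else 0)

IsCycle : (G : Graph) → Fin (n G) → List (Fin (n G)) → Set
IsCycle G v vs = (2 ≤ length vs) × Unique (v ∷ vs) × Linked (Adj G) ((v ∷ vs) ∷ʳ v)

IsForest : Graph → Set
IsForest G = ∀ v vs → ¬ IsCycle G v vs

n₁ : Graph → ℕ
n₁ G = ∑ (λ v → if deg G v ≡ᵇ 1 then 1 else 0)

record TotalWeighting (G : Graph) (s : ℕ) : Set where
  field
    vw       : Fin (n G) → ℕ
    ew       : Fin (n G) → Fin (n G) → ℕ
    vw-range : ∀ v → 1 ≤ vw v × vw v ≤ s
    ew-range : ∀ u v → Adj G u v → 1 ≤ ew u v × ew u v ≤ s
    ew-sym   : ∀ u v → Adj G u v → ew u v ≡ ew v u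
open TotalWeighting public

wt : {G : Graph} {s : ℕ} → TotalWeighting G s → Fin (n G) → ℕ
wt {G} w v = vw w v + ∑ (λ u → if adj G v u then ew w v u else 0)

Irregular : {G : Graph} {s : ℕ} → TotalWeighting G s → Set
Irregular {G} w = ∀ u v → u ≢ v → wt w u ≢ wt w v

TvsIs : Graph → ℕ → Set
TvsIs G s = Σ (TotalWeighting G s) Irregular
          × (∀ t → Σ (TotalWeighting G t) Irregular → s ≤ t)

{-# OPTIONS --safe #-}
module Submission where

-- Lower bound: the leaves have distinct weights in [2 , 2t].
--
-- Upper bound, with L leaves, S = ⌊L/2⌋ and s = S + 1.  The leaves are ranked 0 , … , L − 1; the
-- leaf of rank r gets weight r + 2, its edge min(s , r + 1), and every other edge gets s.  The
-- small leaves (r < S) are handed out so that at each inner vertex they form pairs of ranks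
-- x and S − 1 − x, whose edges add up to s, and at most one is left single.  The edges at v then
-- add up to t s + ε, where t = deg v − ⌈a v/2⌉, a v is the number of small leaves at v, and ε is 0
-- or the edge of the single leaf, so v can be given a weight in the window [t s + 1 , t s + s]
-- (for deg v = 2 it gets 2s + 1).  It remains to keep every window at s vertices or fewer.  Only
-- t = 3 is critical: there one serves the vertices of degree 3 that have leaves first, and
-- then fills the other vertices one after the other; the count follows from the bound
-- Σ deg ≤ 2 |P| for sub-forests P, applied to the whole forest and to its inner vertices.

-- The obstacle is cubic forests. Leaf weights end at 2s, so inner vertices can use the windows from
-- t = 2 on. If every edge had label s, a vertex of degree d would sit in window d. But a tree whose
-- inner vertices all have degree 3 has L - 2 of them, about twice what one window holds. Small
-- leaves are the remedy: one of them moves a vertex of degree 3 down to t = 2, and there are S to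
-- spend. Window 2 then holds at most S vertices with a small leaf and the single possible vertex of
-- degree 2, hence the size S + 1.
--
-- Two things can still crowd window 3. Vertices of degree 3 without leaves cannot be moved, but
-- each has three inner neighbours, which forces additional leaves elsewhere; the second use of the
-- forest bound measures this. Surplus small leaves may drag vertices of degree 4 down into window
-- 3; filling vertices completely, one at a time, confines the harmful case to at most one vertex.
--
-- Isolated edges need separate care: both ends are leaves sharing one edge, so their ranks may
-- differ by at most S. This is why both leaves have one owner, and why one big rank is moved to the
-- front.

open import Defs hiding (sym)
open import Data.Bool using (Bool; true; false; if_then_else_; not; _∧_; _∨_; T)
import Data.Bool as Bool
open import Data.Bool.Properties using (T-≡; ∧-zeroʳ)
open import Data.Empty using (⊥)
open import Data.Fin using (Fin; zero; suc; toℕ; fromℕ<; _≟_)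
open import Data.Fin.Properties using (toℕ-injective; toℕ<n; toℕ-fromℕ<; any?; pigeonhole)
import Data.Fin.Properties as Fin
open import Data.List using (List; []; _∷_; _∷ʳ_; _++_; length; lookup; allFin)
open import Data.List.Membership.DecPropositional using (_∈?_)
open import Data.List.Membership.Propositional using (_∈_)
open import Data.List.Membership.Propositional.Properties using (∈-∃++; ∈-lookup; ∈-allFin)
open import Data.List.Relation.Unary.All using (All; []; _∷_)
import Data.List.Relation.Unary.All as All
open import Data.List.Relation.Unary.All.Properties using (++⁻ˡ; ++⁻ʳ; ¬Any⇒All¬)
open import Data.List.Relation.Unary.AllPairs using ([]; _∷_)
open import Data.List.Relation.Unary.Any using (here; there)
open import Data.List.Relation.Unary.Linked using (Linked; [-]; _∷_)
open import Data.List.Relation.Unary.Unique.Propositional using (Unique)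
open import Data.Nat using (ℕ; zero; suc; _+_; _*_; _∸_; _≤_; _<_; _⊓_; _⊔_; z≤n; s≤s; z<s; _≡ᵇ_; _<ᵇ_; ⌈_/2⌉; ⌊_/2⌋; _≤?_; _<?_)
open import Data.Nat.Properties hiding (_≟_; _≤?_; _<?_)
import Data.Nat.Properties as ℕ
open import Data.Nat.Tactic.RingSolver using (solve-∀)
open import Data.Product using (Σ; ∃; _×_; _,_; proj₁; proj₂)
open import Data.Sum using (_⊎_; inj₁; inj₂)
open import Function using (_∘_)
open import Function.Bundles using (Equivalence)
open import Relation.Binary.Definitions using (tri<; tri≈; tri>)
open import Relation.Binary.PropositionalEquality using (_≡_; _≢_; refl; sym; trans; cong; cong₂; subst; subst₂; ≢-sym; module ≡-Reasoning)
open import Relation.Nullary using (¬_; Dec; yes; no; does; contradiction)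
open import Relation.Nullary.Decidable using (_×-dec_; ¬?; dec-true; dec-false)

-- Finite sums and counting

-- A linear inequality X ≤ Y follows from A ≤ B as soon as X + B + e = Y + A for some
-- slack e, which is a semiring identity.
lin : ∀ {A B X Y} e → A ≤ B → X + B + e ≡ Y + A → X ≤ Y
lin {A} {B} {X} {Y} e A≤B eq = +-cancelʳ-≤ B X Y
  (≤-trans (m≤m+n (X + B) e) (≤-trans (≤-reflexive eq) (+-monoʳ-≤ Y A≤B)))

+-interchange : ∀ a b c d → a + b + (c + d) ≡ a + c + (b + d)
+-interchange = solve-∀

𝟙 : Bool → ℕ
𝟙 b = if b then 1 else 0

count : ∀ {n} → (Fin n → Bool) → ℕ
count P = ∑ (λ i → 𝟙 (P i))

_==_ : ∀ {n} → Fin n → Fin n → Bool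
i == j = does (i ≟ j)

==-refl : ∀ {n} (i : Fin n) → (i == i) ≡ true
==-refl i = dec-true (i ≟ i) refl

==⇒≡ : ∀ {n} {i j : Fin n} → (i == j) ≡ true → i ≡ j
==⇒≡ {i = i} {j} h with i ≟ j
... | yes eq = eq
... | no _ with () ← h

≡ᵇ-true⇒≡ : ∀ {m n} → (m ≡ᵇ n) ≡ true → m ≡ n
≡ᵇ-true⇒≡ {m} {n} h = ≡ᵇ⇒≡ m n (Equivalence.from T-≡ h)

≡⇒≡ᵇ-true : ∀ {m n} → m ≡ n → (m ≡ᵇ n) ≡ true
≡⇒≡ᵇ-true {m} {n} h = Equivalence.to T-≡ (≡⇒≡ᵇ m n h)

≢⇒≡ᵇ-false : ∀ {m n} → m ≢ n → (m ≡ᵇ n) ≡ false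
≢⇒≡ᵇ-false {m} {n} h with m ≡ᵇ n in eq
... | false = refl
... | true = contradiction (≡ᵇ-true⇒≡ eq) h

∧-true : ∀ {a b} → a ∧ b ≡ true → a ≡ true × b ≡ true
∧-true {true} {true} _ = refl , refl

∧-intro : ∀ {a b} → a ≡ true → b ≡ true → a ∧ b ≡ true
∧-intro refl refl = refl

𝟙≤1 : ∀ b → 𝟙 b ≤ 1
𝟙≤1 true = ≤-refl
𝟙≤1 false = z≤n

𝟙-mono : ∀ {a b} → (a ≡ true → b ≡ true) → 𝟙 a ≤ 𝟙 b
𝟙-mono {false} h = z≤n
𝟙-mono {true} h rewrite h refl = ≤-refl

1≤𝟙 : ∀ {b} → b ≡ true → 1 ≤ 𝟙 b
1≤𝟙 refl = ≤-refl

∑-cong : ∀ {n} {f g : Fin n → ℕ} → (∀ i → f i ≡ g i) → ∑ f ≡ ∑ g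
∑-cong {zero} h = refl
∑-cong {suc n} h = cong₂ _+_ (h zero) (∑-cong (h ∘ suc))

∑-mono : ∀ {n} {f g : Fin n → ℕ} → (∀ i → f i ≤ g i) → ∑ f ≤ ∑ g
∑-mono {zero} h = z≤n
∑-mono {suc n} h = +-mono-≤ (h zero) (∑-mono (h ∘ suc))

∑-distrib-+ : ∀ {n} (f g : Fin n → ℕ) → ∑ (λ i → f i + g i) ≡ ∑ f + ∑ g
∑-distrib-+ {zero} f g = refl
∑-distrib-+ {suc n} f g rewrite ∑-distrib-+ (f ∘ suc) (g ∘ suc) =
  +-interchange (f zero) (g zero) (∑ (f ∘ suc)) (∑ (g ∘ suc))

∑-distribˡ-* : ∀ {n} c (f : Fin n → ℕ) → ∑ (λ i → c * f i) ≡ c * ∑ f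
∑-distribˡ-* {zero} c f = sym (*-zeroʳ c)
∑-distribˡ-* {suc n} c f rewrite ∑-distribˡ-* c (f ∘ suc) = sym (*-distribˡ-+ c (f zero) _)

∑-distribʳ-* : ∀ {n} (f : Fin n → ℕ) c → ∑ (λ i → f i * c) ≡ ∑ f * c
∑-distribʳ-* f c = trans (∑-cong (λ i → *-comm (f i) c)) (trans (∑-distribˡ-* c f) (*-comm c (∑ f)))

∑-const : ∀ {n} c → ∑ {n} (λ _ → c) ≡ n * c
∑-const {zero} c = refl
∑-const {suc n} c = cong (c +_) (∑-const {n} c)

∑-zero : ∀ {n} {f : Fin n → ℕ} → (∀ i → f i ≡ 0) → ∑ f ≡ 0
∑-zero {n} h = trans (∑-cong h) (trans (∑-const {n} 0) (*-zeroʳ n))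

∑-comm : ∀ {m n} (f : Fin m → Fin n → ℕ) → ∑ (λ i → ∑ (f i)) ≡ ∑ (λ j → ∑ (λ i → f i j))
∑-comm {zero} {n} f = sym (∑-zero {n} (λ _ → refl))
∑-comm {suc m} f rewrite ∑-comm (f ∘ suc) = sym (∑-distrib-+ (f zero) _)

term≤∑ : ∀ {n} (f : Fin n → ℕ) i → f i ≤ ∑ f
term≤∑ f zero = m≤m+n _ _
term≤∑ f (suc i) = ≤-trans (term≤∑ (f ∘ suc) i) (m≤n+m _ _)

∑-single : ∀ {n} (f : Fin n → ℕ) x → (∀ i → i ≢ x → f i ≡ 0) → ∑ f ≡ f x
∑-single f zero h = trans (cong (f zero +_) (∑-zero (λ i → h (suc i) (λ ())))) (+-identityʳ _)
∑-single f (suc x) h =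
  trans (cong (_+ ∑ (f ∘ suc)) (h zero (λ ())))
        (∑-single (f ∘ suc) x (λ i i≢x → h (suc i) (i≢x ∘ Fin.suc-injective)))

count-mono : ∀ {n} {P Q : Fin n → Bool} → (∀ i → P i ≡ true → Q i ≡ true) → count P ≤ count Q
count-mono h = ∑-mono (λ i → 𝟙-mono (h i))

count-≥1 : ∀ {n} (P : Fin n → Bool) i → P i ≡ true → 1 ≤ count P
count-≥1 P i h = ≤-trans (1≤𝟙 h) (term≤∑ (𝟙 ∘ P) i)

count-≤1 : ∀ {n} (P : Fin n → Bool) → (∀ i j → P i ≡ true → P j ≡ true → i ≡ j) → count P ≤ 1
count-≤1 {zero} P h = z≤n
count-≤1 {suc n} P h with P zero in eq
... | true = s≤s (≤-reflexive (∑-zero rest))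
  where
  rest : ∀ i → 𝟙 (P (suc i)) ≡ 0
  rest i with P (suc i) in eq′
  ... | false = refl
  ... | true with () ← h zero (suc i) eq eq′
... | false = count-≤1 (P ∘ suc) (λ i j p q → Fin.suc-injective (h (suc i) (suc j) p q))

count-== : ∀ {n} (x : Fin n) → count (_== x) ≡ 1
count-== x = trans (∑-single (λ i → 𝟙 (i == x)) x off) (cong 𝟙 (==-refl x))
  where
  off : ∀ i → i ≢ x → 𝟙 (i == x) ≡ 0
  off i i≢x = cong 𝟙 (dec-false (i ≟ x) i≢x)

∃-true? : ∀ {n} (P : Fin n → Bool) → Dec (∃ λ i → P i ≡ true)
∃-true? P = any? (λ i → P i Bool.≟ true)

none⇒count≡0 : ∀ {n} (P : Fin n → Bool) → ¬ (∃ λ i → P i ≡ true) → count P ≡ 0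
none⇒count≡0 P h = ∑-zero zeros
  where
  zeros : ∀ i → 𝟙 (P i) ≡ 0
  zeros i with P i in eq
  ... | true = contradiction (i , eq) h
  ... | false = refl

count>0⇒∃ : ∀ {n} (P : Fin n → Bool) → 1 ≤ count P → ∃ λ i → P i ≡ true
count>0⇒∃ P h with ∃-true? P
... | yes p = p
... | no ¬p with () ← subst (1 ≤_) (none⇒count≡0 P ¬p) h

another : ∀ {n} (P : Fin n → Bool) → 2 ≤ count P → ∀ y → ∃ λ i → P i ≡ true × i ≢ y
another P h y with any? (λ i → (P i Bool.≟ true) ×-dec ¬? (i ≟ y))
... | yes p = p
... | no ¬p = contradiction (≤-trans h (count-≤1 P only)) λ { (s≤s ()) }
  where
  at-y : ∀ i → P i ≡ true → i ≡ y
  at-y i pi with i ≟ y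
  ... | yes eq = eq
  ... | no i≢y = contradiction (i , pi , i≢y) ¬p
  only : ∀ i j → P i ≡ true → P j ≡ true → i ≡ j
  only i j pi pj = trans (at-y i pi) (sym (at-y j pj))

-- Double counting of the pairs (i , p) with P i and f i = p.
private
  hits : ∀ {n} → (Fin n → Bool) → (Fin n → ℕ) → ℕ → Fin n → Bool
  hits P f p i = P i ∧ (f i ≡ᵇ p)

count-injection : ∀ {n} (P : Fin n → Bool) (f : Fin n → ℕ) m
  → (∀ i → P i ≡ true → f i < m)
  → (∀ i j → P i ≡ true → P j ≡ true → f i ≡ f j → i ≡ j)
  → count P ≤ m
count-injection {n} P f m f<m inj = begin
  count P                                              ≤⟨ ∑-mono row ⟩
  ∑ {n} (λ i → ∑ {m} (λ p → 𝟙 (hits P f (toℕ p) i)))   ≡⟨ ∑-comm {n} {m} (λ i p → 𝟙 (hits P f (toℕ p) i)) ⟩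
  ∑ {m} (λ p → count (hits P f (toℕ p)))               ≤⟨ ∑-mono {m} column ⟩
  ∑ {m} (λ _ → 1)                                      ≡⟨ trans (∑-const {m} 1) (*-identityʳ m) ⟩
  m                                                    ∎
  where
  open ≤-Reasoning
  row : ∀ i → 𝟙 (P i) ≤ ∑ {m} (λ p → 𝟙 (hits P f (toℕ p) i))
  row i with P i in eq
  ... | false = z≤n
  ... | true = count-≥1 {m} (λ p → f i ≡ᵇ toℕ p) (fromℕ< (f<m i eq))
                 (≡⇒≡ᵇ-true (sym (toℕ-fromℕ< (f<m i eq))))
  column : ∀ (p : Fin m) → count (hits P f (toℕ p)) ≤ 1
  column p = count-≤1 _ λ i j hi hj → let (pi , fi) = ∧-true hi ; (pj , fj) = ∧-true hj in
    inj i j pi pj (trans (≡ᵇ-true⇒≡ {f i} fi) (sym (≡ᵇ-true⇒≡ {f j} fj)))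

unused-value : ∀ {n} (P : Fin n → Bool) (f : Fin n → ℕ) m → count P < m
  → ∃ λ p → p < m × (∀ i → P i ≡ true → f i ≢ p)
unused-value {n} P f m few with any? (λ (p : Fin m) → ¬? (∃-true? (hits P f (toℕ p))))
... | yes (p , free) = toℕ p , toℕ<n p , λ i pi fi → free (i , ∧-intro pi (≡⇒≡ᵇ-true fi))
... | no all-used = contradiction few (≤⇒≯ many)
  where
  open ≤-Reasoning
  column : ∀ (p : Fin m) → 1 ≤ count (hits P f (toℕ p))
  column p with ∃-true? (hits P f (toℕ p))
  ... | yes (i , h) = count-≥1 _ i h
  ... | no ¬h = contradiction (p , ¬h) all-used
  row : ∀ i → ∑ {m} (λ p → 𝟙 (hits P f (toℕ p) i)) ≤ 𝟙 (P i)
  row i with P i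
  ... | false = ≤-reflexive (∑-zero {m} (λ _ → refl))
  ... | true = count-≤1 {m} (λ p → f i ≡ᵇ toℕ p) λ p q hp hq →
                 toℕ-injective (trans (sym (≡ᵇ-true⇒≡ {f i} hp)) (≡ᵇ-true⇒≡ {f i} hq))
  many : m ≤ count P
  many = begin
    m                                                    ≡⟨ *-identityʳ m ⟨
    m * 1                                                ≡⟨ ∑-const {m} 1 ⟨
    ∑ {m} (λ _ → 1)                                      ≤⟨ ∑-mono {m} column ⟩
    ∑ {m} (λ p → count (hits P f (toℕ p)))               ≡⟨ ∑-comm {m} {n} (λ p i → 𝟙 (hits P f (toℕ p) i)) ⟩
    ∑ {n} (λ i → ∑ {m} (λ p → 𝟙 (hits P f (toℕ p) i)))   ≤⟨ ∑-mono row ⟩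
    count P                                              ∎

-- Ranks, fillings and placements

-- Cuts the numbers below `∑ k` into consecutive blocks, one of length `k v` for each `v`, with
-- `prefix k v + j` the slot `j` of block `v`. All ranks below are such slots; a 0/1-valued `k`
-- gives the rank within a subset.
prefix : ∀ {n} → (Fin n → ℕ) → Fin n → ℕ
prefix k zero = 0
prefix k (suc i) = k zero + prefix (k ∘ suc) i

prefix-slot-< : ∀ {n} (k : Fin n → ℕ) v {j} → j < k v → prefix k v + j < ∑ k
prefix-slot-< k zero j<k = ≤-trans j<k (m≤m+n _ _)
prefix-slot-< k (suc v) {j} j<k =
  subst (_< ∑ k) (sym (+-assoc (k zero) (prefix (k ∘ suc) v) j))
    (+-monoʳ-< (k zero) (prefix-slot-< (k ∘ suc) v j<k))

prefix-slot-injective : ∀ {n} (k : Fin n → ℕ) v w {i j} → i < k v → j < k w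
  → prefix k v + i ≡ prefix k w + j → v ≡ w × i ≡ j
prefix-slot-injective k zero zero i< j< eq = refl , eq
prefix-slot-injective k zero (suc w) {i} {j} i< j< eq =
  contradiction (subst (_< k zero) eq i<)
    (≤⇒≯ (≤-trans (m≤m+n (k zero) (prefix (k ∘ suc) w)) (m≤m+n _ j)))
prefix-slot-injective k (suc v) zero {i} {j} i< j< eq =
  contradiction (subst (_< k zero) (sym eq) j<)
    (≤⇒≯ (≤-trans (m≤m+n (k zero) (prefix (k ∘ suc) v)) (m≤m+n _ i)))
prefix-slot-injective k (suc v) (suc w) {i} {j} i< j< eq =
  let (v≡w , i≡j) = prefix-slot-injective (k ∘ suc) v w i< j<
                      (+-cancelˡ-≡ (k zero) _ _
                        (trans (sym (+-assoc (k zero) _ i)) (trans eq (+-assoc (k zero) _ j))))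
  in cong suc v≡w , i≡j

rank : ∀ {n} → (Fin n → Bool) → Fin n → ℕ
rank P = prefix (𝟙 ∘ P)

rank-<-count : ∀ {n} (P : Fin n → Bool) v → P v ≡ true → rank P v < count P
rank-<-count P v pv = subst (_< count P) (+-identityʳ _) (prefix-slot-< (𝟙 ∘ P) v (1≤𝟙 pv))

rank-injective : ∀ {n} (P : Fin n → Bool) v w → P v ≡ true → P w ≡ true → rank P v ≡ rank P w → v ≡ w
rank-injective P v w pv pw eq =
  proj₁ (prefix-slot-injective (𝟙 ∘ P) v w (1≤𝟙 pv) (1≤𝟙 pw) (cong (_+ 0) eq))

∑< : ℕ → (ℕ → ℕ) → ℕ
∑< zero f = 0
∑< (suc m) f = f 0 + ∑< m (f ∘ suc)

∑<-+ : ∀ m k (f : ℕ → ℕ) → ∑< (m + k) f ≡ ∑< m f + ∑< k (λ j → f (m + j))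
∑<-+ zero k f = refl
∑<-+ (suc m) k f rewrite ∑<-+ m k (f ∘ suc) = sym (+-assoc (f 0) _ _)

∑<-cong : ∀ m {f g : ℕ → ℕ} → (∀ j → j < m → f j ≡ g j) → ∑< m f ≡ ∑< m g
∑<-cong zero h = refl
∑<-cong (suc m) h = cong₂ _+_ (h 0 z<s) (∑<-cong m (λ j j<m → h (suc j) (s≤s j<m)))

∑<-const : ∀ m c → ∑< m (λ _ → c) ≡ m * c
∑<-const zero c = refl
∑<-const (suc m) c = cong (c +_) (∑<-const m c)

∑<-distrib-+ : ∀ m (f g : ℕ → ℕ) → ∑< m f + ∑< m g ≡ ∑< m (λ j → f j + g j)
∑<-distrib-+ zero f g = refl
∑<-distrib-+ (suc m) f g rewrite sym (∑<-distrib-+ m (f ∘ suc) (g ∘ suc)) =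
  +-interchange (f 0) (∑< m (f ∘ suc)) (g 0) (∑< m (g ∘ suc))

-- Turns a sum over the leaves of one vertex into a sum over their indices, where the index range
-- can be cut into zones.
∑-by-rank : ∀ {n} (P : Fin n → Bool) (f : ℕ → ℕ)
  → ∑ (λ u → if P u then f (rank P u) else 0) ≡ ∑< (count P) f
∑-by-rank {zero} P f = refl
∑-by-rank {suc n} P f with P zero
... | true = cong (f 0 +_) (∑-by-rank (P ∘ suc) (f ∘ suc))
... | false = ∑-by-rank (P ∘ suc) f

-- Raising lo to cap one coordinate after the other passes through every total in between,
-- and at each moment only the coordinate being raised differs from both bounds.
fill : ∀ {n} (lo cap : Fin n → ℕ) m → (∀ i → lo i ≤ cap i) → ∑ lo ≤ m → m ≤ ∑ cap
  → ∃ λ (a : Fin n → ℕ) → (∀ i → lo i ≤ a i × a i ≤ cap i) × ∑ a ≡ m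
    × (∀ i j → a i ≢ lo i → a i ≢ cap i → a j ≢ lo j → a j ≢ cap j → i ≡ j)
fill {zero} lo cap m lo≤cap lo≤m m≤cap = lo , (λ ()) , sym (n≤0⇒n≡0 m≤cap) , λ ()
fill {suc n} lo cap m lo≤cap lo≤m m≤cap with ≤-total m (cap zero + ∑ (lo ∘ suc))
... | inj₁ m≤ = a , bounds , total , one
  where
  rest = ∑ (lo ∘ suc)
  a : Fin (suc n) → ℕ
  a zero = m ∸ rest
  a (suc i) = lo (suc i)
  bounds : ∀ i → lo i ≤ a i × a i ≤ cap i
  bounds zero = subst (_≤ m ∸ rest) (m+n∸n≡m (lo zero) rest) (∸-monoˡ-≤ rest lo≤m)
              , subst (m ∸ rest ≤_) (m+n∸n≡m (cap zero) rest) (∸-monoˡ-≤ rest m≤)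
  bounds (suc i) = ≤-refl , lo≤cap (suc i)
  total : ∑ a ≡ m
  total = m∸n+n≡m (≤-trans (m≤n+m rest (lo zero)) lo≤m)
  one : ∀ i j → a i ≢ lo i → a i ≢ cap i → a j ≢ lo j → a j ≢ cap j → i ≡ j
  one zero zero _ _ _ _ = refl
  one (suc i) _ ai _ _ _ = contradiction refl ai
  one zero (suc j) _ _ aj _ = contradiction refl aj
... | inj₂ m≥ with fill (lo ∘ suc) (cap ∘ suc) (m ∸ cap zero) (lo≤cap ∘ suc) lo≤′ ≤cap′
  where
  lo≤′ = subst (_≤ m ∸ cap zero) (m+n∸m≡n (cap zero) _) (∸-monoˡ-≤ (cap zero) m≥)
  ≤cap′ = subst (m ∸ cap zero ≤_) (m+n∸m≡n (cap zero) _) (∸-monoˡ-≤ (cap zero) m≤cap)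
... | a′ , bounds′ , total′ , one′ = a , bounds , total , one
  where
  a : Fin (suc n) → ℕ
  a zero = cap zero
  a (suc i) = a′ i
  bounds : ∀ i → lo i ≤ a i × a i ≤ cap i
  bounds zero = lo≤cap zero , ≤-refl
  bounds (suc i) = bounds′ i
  total : ∑ a ≡ m
  total = trans (cong (cap zero +_) total′) (m+[n∸m]≡n (≤-trans (m≤m+n (cap zero) _) m≥))
  one : ∀ i j → a i ≢ lo i → a i ≢ cap i → a j ≢ lo j → a j ≢ cap j → i ≡ j
  one zero _ _ ai _ _ = contradiction refl ai
  one (suc i) zero _ _ _ aj = contradiction refl aj
  one (suc i) (suc j) p q r t = cong suc (one′ i j p q r t)

-- Greedy completion of a partial injection in every band at once. A band will be a window and `f`
-- the offset inside it; `D` marks the vertices that already have their offset and keep it.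
module Spread {n} (s : ℕ) (P : Fin n → Bool) (band : Fin n → ℕ)
  (few : ∀ b → count (λ v → P v ∧ (band v ≡ᵇ b)) ≤ s) where

  record Placement (D : Fin n → Bool) (f : Fin n → ℕ) : Set where
    field
      D⊆P : ∀ v → D v ≡ true → P v ≡ true
      range : ∀ v → D v ≡ true → f v < s
      inj : ∀ v w → D v ≡ true → D w ≡ true → band v ≡ band w → f v ≡ f w → v ≡ w
  open Placement

  Extension : (Fin n → Bool) → (Fin n → ℕ) → (Fin n → Set) → Set
  Extension D f Q = ∃ λ D′ → ∃ λ f′ → Placement D′ f′
    × (∀ v → D v ≡ true → D′ v ≡ true × f′ v ≡ f v)
    × (∀ v → P v ≡ true → Q v → D′ v ≡ true)

  place : ∀ D f → Placement D f → ∀ x → D x ≡ false → P x ≡ true → Extension D f (_≡ x)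
  place D f pl x Dx Px = D′ , f′ , pl′ , (λ v Dv → ∨-intro Dv , old v Dv) , λ { v _ refl → at-x }
    where
    here? : Fin n → Bool
    here? v = D v ∧ (band v ≡ᵇ band x)
    -- The vertex `x` belongs to its own band and is not yet placed, so the placed ones are at least
    -- one fewer than the band holds.
    room : count here? < s
    room = ≤-trans (≤-trans (s≤s ≤-refl) more) (few (band x))
      where
      in-band : Fin n → Bool
      in-band v = P v ∧ (band v ≡ᵇ band x)
      pointwise : ∀ v → 𝟙 (v == x) + 𝟙 (here? v) ≤ 𝟙 (in-band v)
      pointwise v with v ≟ x
      ... | yes refl rewrite Dx | Px | ≡⇒≡ᵇ-true {band v} refl = ≤-refl
      ... | no _ = 𝟙-mono λ h → let (Dv , e) = ∧-true {D v} h in ∧-intro (D⊆P pl v Dv) e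
      more : 1 + count here? ≤ count in-band
      more = subst (_≤ count in-band)
        (trans (∑-distrib-+ (λ v → 𝟙 (v == x)) (𝟙 ∘ here?)) (cong (_+ count here?) (count-== x)))
        (∑-mono pointwise)
    free = unused-value here? f s room
    p = proj₁ free
    D′ : Fin n → Bool
    D′ v = D v ∨ (v == x)
    f′ : Fin n → ℕ
    f′ v = if v == x then p else f v
    ∨-intro : ∀ {a b} → a ≡ true → a ∨ b ≡ true
    ∨-intro refl = refl
    at-x : D′ x ≡ true
    at-x rewrite Dx = ==-refl x
    old : ∀ v → D v ≡ true → f′ v ≡ f v
    old v Dv with v ≟ x
    ... | no _ = refl
    ... | yes refl with () ← trans (sym Dv) Dx
    split : ∀ v → D′ v ≡ true → (v ≡ x × f′ v ≡ p) ⊎ (D v ≡ true × f′ v ≡ f v)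
    split v h with v ≟ x
    ... | yes eq = inj₁ (eq , refl)
    ... | no _ with true ← D v = inj₂ (refl , refl)
    fresh : ∀ v → D v ≡ true → band v ≡ band x → f v ≢ p
    fresh v Dv e = proj₂ (proj₂ free) v (∧-intro Dv (≡⇒≡ᵇ-true e))
    pl′ : Placement D′ f′
    pl′ .D⊆P v h with split v h
    ... | inj₁ (refl , _) = Px
    ... | inj₂ (Dv , _) = D⊆P pl v Dv
    pl′ .range v h with split v h
    ... | inj₁ (_ , e) = subst (_< s) (sym e) (proj₁ (proj₂ free))
    ... | inj₂ (Dv , e) = subst (_< s) (sym e) (range pl v Dv)
    pl′ .inj v w hv hw bb ff with split v hv | split w hw
    ... | inj₁ (refl , _) | inj₁ (refl , _) = refl
    ... | inj₁ (refl , e) | inj₂ (Dw , e′) =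
      contradiction (trans (sym e′) (trans (sym ff) e)) (fresh w Dw (sym bb))
    ... | inj₂ (Dv , e) | inj₁ (refl , e′) =
      contradiction (trans (sym e) (trans ff e′)) (fresh v Dv bb)
    ... | inj₂ (Dv , e) | inj₂ (Dw , e′) = inj pl v w Dv Dw bb (trans (sym e) (trans ff e′))

  place-all : ∀ xs D f → Placement D f → Extension D f (_∈ xs)
  place-all [] D f pl = D , f , pl , (λ v Dv → Dv , refl) , λ _ _ ()
  place-all (x ∷ xs) D f pl with D x in Dx | P x in Px
  ... | false | true =
    let (D₁ , f₁ , pl₁ , ext₁ , new₁) = place D f pl x Dx Px
        (D₂ , f₂ , pl₂ , ext₂ , new₂) = place-all xs D₁ f₁ pl₁
    in D₂ , f₂ , pl₂
     , (λ v Dv → let (d₁ , e₁) = ext₁ v Dv ; (d₂ , e₂) = ext₂ v d₁ in d₂ , trans e₂ e₁)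
     , λ { v Pv (here refl) → proj₁ (ext₂ v (new₁ v Pv refl)) ; v Pv (there m) → new₂ v Pv m }
  ... | true | _ =
    let (D₂ , f₂ , pl₂ , ext₂ , new₂) = place-all xs D f pl
    in D₂ , f₂ , pl₂ , ext₂
     , λ { v Pv (here refl) → proj₁ (ext₂ v Dx) ; v Pv (there m) → new₂ v Pv m }
  ... | false | false =
    let (D₂ , f₂ , pl₂ , ext₂ , new₂) = place-all xs D f pl
    in D₂ , f₂ , pl₂ , ext₂
     , λ { v Pv (here refl) → contradiction (trans (sym Px) Pv) (λ ()) ; v Pv (there m) → new₂ v Pv m }

  spread : ∀ D f → Placement D f → ∃ λ f′
    → (∀ v → P v ≡ true → f′ v < s)
    × (∀ v w → P v ≡ true → P w ≡ true → band v ≡ band w → f′ v ≡ f′ w → v ≡ w)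
    × (∀ v → D v ≡ true → f′ v ≡ f v)
  spread D f pl with place-all (allFin n) D f pl
  ... | D′ , f′ , pl′ , ext , new =
      f′
    , (λ v Pv → range pl′ v (new v Pv (∈-allFin v)))
    , (λ v w Pv Pw → inj pl′ v w (new v Pv (∈-allFin v)) (new w Pw (∈-allFin w)))
    , λ v Dv → proj₂ (ext v Dv)

-- Edges of sub-forests

unique-lookup : ∀ {A : Set} {xs : List A} → Unique xs → ∀ {i j} → toℕ i < toℕ j → lookup xs i ≢ lookup xs j
unique-lookup (x∉ ∷ _) {zero} {suc j} _ = All.lookup x∉ (∈-lookup j)
unique-lookup (_ ∷ u) {suc i} {suc j} (s≤s i<j) = unique-lookup u i<j

unique-length : ∀ {n} {xs : List (Fin n)} → Unique xs → length xs ≤ n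
unique-length {n} {xs} uniq with length xs ≤? n
... | yes le = le
... | no ≰ with pigeonhole (≰⇒> ≰) (lookup xs)
... | i , j , i<j , eq = contradiction eq (unique-lookup uniq i<j)

unique-before : ∀ {A : Set} as {bs} {w : A} → Unique (as ++ w ∷ bs) → Unique (w ∷ as)
unique-before [] (_ ∷ _) = [] ∷ []
unique-before (a ∷ as) (a∉ ∷ u) with unique-before as u | ++⁻ʳ as a∉
... | w∉ ∷ u′ | a≢w ∷ _ = (≢-sym a≢w ∷ w∉) ∷ (++⁻ˡ as a∉ ∷ u′)

linked-upto : ∀ {A : Set} {R : A → A → Set} as {bs} {w : A} → Linked R (as ++ w ∷ bs) → Linked R (as ∷ʳ w)
linked-upto [] _ = [-]
linked-upto (a ∷ []) (r ∷ _) = r ∷ [-]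
linked-upto (a ∷ b ∷ as) (r ∷ l) = r ∷ linked-upto (b ∷ as) l

module _ (G : Graph) where

  private
    V : Set
    V = Fin (n G)

  adj-sym : ∀ {u v} → Adj G u v → Adj G v u
  adj-sym {u} {v} = trans (Graph.sym G v u)

  adj⇒≢ : ∀ {u v} → Adj G u v → u ≢ v
  adj⇒≢ {u} uv refl with () ← trans (sym uv) (irrefl G u)

  -- The degree in the subgraph induced by `P`, and 0 outside `P`, so that the sum over all vertices
  -- is twice the number of induced edges.
  inner-deg : (V → Bool) → V → ℕ
  inner-deg P v = count (λ u → P v ∧ P u ∧ adj G v u)

  module _ (forest : IsForest G) (P : V → Bool) (deg≥2 : ∀ v → P v ≡ true → 2 ≤ inner-deg P v) where

    -- The path has no repetition, and grows at its head without turning back.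
    private
      grow : ∀ fuel x xs → P x ≡ true → Unique (x ∷ xs) → Linked (Adj G) (x ∷ xs)
        → n G < fuel + length (x ∷ xs) → ⊥
      step : ∀ fuel x xs w → P w ≡ true → Adj G w x → (∀ {y ys} → xs ≡ y ∷ ys → w ≢ y)
        → Unique (x ∷ xs) → Linked (Adj G) (x ∷ xs)
        → n G < suc fuel + length (x ∷ xs) → ⊥

      next : ∀ x y → P x ≡ true → ∃ λ w → P w ≡ true × Adj G w x × w ≢ y
      next x y Px with another _ (deg≥2 x Px) y
      ... | w , h , w≢y with ∧-true {P x} h
      ... | _ , h′ with ∧-true {P w} h′
      ... | Pw , xw = w , Pw , adj-sym xw , w≢y

      -- Fuel plus length stays above the number of vertices, so without fuel the path would be too
      -- long to be free of repetition.
      grow zero x xs Px uniq link big = contradiction (unique-length uniq) (<⇒≱ big)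
      grow (suc fuel) x [] Px uniq link big =
        let (w , Pw , wx , _) = next x x Px in step fuel x [] w Pw wx (λ ()) uniq link big
      grow (suc fuel) x (y ∷ ys) Px uniq link big =
        let (w , Pw , wx , w≢y) = next x y Px in
        step fuel x (y ∷ ys) w Pw wx (λ { refl → w≢y }) uniq link big

      step fuel x xs w Pw wx w≢y uniq link big with _∈?_ _≟_ w (x ∷ xs)
      ... | no w∉ = grow fuel w (x ∷ xs) Pw (¬Any⇒All¬ _ w∉ ∷ uniq) (wx ∷ link)
                      (subst (n G <_) (sym (+-suc fuel _)) big)
      ... | yes (here refl) = adj⇒≢ wx refl
      ... | yes (there w∈) with ∈-∃++ w∈
      ... | [] , bs , refl = w≢y refl refl
      -- The new vertex already lies on the path, beyond the predecessor `y` of `x`; the stretch of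
      -- path up to that occurrence closes to a cycle with at least three vertices.
      ... | y ∷ as , bs , refl =
        forest w (x ∷ y ∷ as)
          (s≤s (s≤s z≤n) , unique-before (x ∷ y ∷ as) uniq , wx ∷ linked-upto (x ∷ y ∷ as) link)

    all-deg≥2⇒empty : ∀ v → P v ≢ true
    all-deg≥2⇒empty v Pv = grow (n G) v [] Pv ([] ∷ []) [-] (≤-reflexive (+-comm 1 (n G)))

  module _ (forest : IsForest G) where

    -- A nonempty induced sub-forest has a vertex of induced degree at most 1. Deleting it lowers
    -- the sum by at most 2: its own degree, and once more at its neighbour.
    forest-edges : ∀ m P → count P ≡ m → ∑ (inner-deg P) ≤ 2 * m
    forest-edges m P eq with any? (λ v → (P v Bool.≟ true) ×-dec (inner-deg P v <? 2))
    forest-edges m P eq | no none = ≤-trans (≤-reflexive (∑-zero empty)) z≤n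
      where
      absent : ∀ v → P v ≢ true
      absent = all-deg≥2⇒empty forest P (λ v Pv → ≮⇒≥ (λ lt → none (v , Pv , lt)))
      empty : ∀ v → inner-deg P v ≡ 0
      empty v with P v in Pv
      ... | true = contradiction Pv (absent v)
      ... | false = ∑-zero {n G} (λ _ → refl)
    forest-edges zero P eq | yes (x , Px , _) with () ← subst (1 ≤_) eq (count-≥1 P x Px)
    forest-edges (suc m) P eq | yes (x , Px , s≤s deg≤1) = begin
      ∑ (inner-deg P)
        ≤⟨ ∑-mono row ⟩
      ∑ (λ v → inner-deg P′ v + (𝟙 (v == x) * inner-deg P x + 𝟙 (P x ∧ P v ∧ adj G x v)))
        ≡⟨ trans (∑-distrib-+ (inner-deg P′) _)
             (cong (∑ (inner-deg P′) +_)
               (trans (∑-distrib-+ (λ v → 𝟙 (v == x) * inner-deg P x) _)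
                 (cong (_+ inner-deg P x) (∑-distribʳ-* (λ v → 𝟙 (v == x)) (inner-deg P x))))) ⟩
      ∑ (inner-deg P′) + (count (_== x) * inner-deg P x + inner-deg P x)
        ≤⟨ +-mono-≤ (forest-edges m P′ count′)
             (+-mono-≤ (*-mono-≤ (≤-reflexive (count-== x)) deg≤1) deg≤1) ⟩
      2 * m + (1 * 1 + 1)
        ≡⟨ arith m ⟩
      2 * suc m ∎
      where
      open ≤-Reasoning
      arith : ∀ m → 2 * m + (1 * 1 + 1) ≡ 2 * suc m
      arith = solve-∀
      P′ : V → Bool
      P′ v = P v ∧ not (v == x)
      count′ : count P′ ≡ m
      count′ = suc-injective (trans (trans (cong (_+ count P′) (sym (count-== x)))
                 (trans (sym (∑-distrib-+ (λ v → 𝟙 (v == x)) (𝟙 ∘ P′))) (∑-cong pointwise))) eq)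
        where
        pointwise : ∀ v → 𝟙 (v == x) + 𝟙 (P′ v) ≡ 𝟙 (P v)
        pointwise v with v ≟ x
        ... | yes refl rewrite Px = refl
        ... | no _ with P v
        ... | true = refl
        ... | false = refl
      middle : ∀ y z c → y ≤ z + (1 * y + c)
      middle y z c = lin (z + c) (z≤n {0}) (slack y z c)
        where
        slack : ∀ y z c → y + 0 + (z + c) ≡ z + (1 * y + c) + 0
        slack = solve-∀
      -- An ordered pair that disappears with `x` has `x` as its first or second entry; the two
      -- correction terms count these cases.
      cell : ∀ v u → 𝟙 (P v ∧ P u ∧ adj G v u) ≤
        𝟙 (P′ v ∧ P′ u ∧ adj G v u) + (𝟙 (v == x) * 𝟙 (P x ∧ P u ∧ adj G x u)
          + 𝟙 (u == x) * 𝟙 (P x ∧ P v ∧ adj G x v))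
      cell v u with v ≟ x | u ≟ x
      ... | yes refl | q = middle (𝟙 (P v ∧ P u ∧ adj G v u)) (𝟙 ((P v ∧ false) ∧ (P u ∧ not (does q)) ∧ adj G v u)) _
      ... | no _ | yes refl rewrite Graph.sym G u v with P v | P u
      ... | true | true = ≤-reflexive (sym (+-identityʳ (𝟙 (adj G v u))))
      ... | true | false = z≤n
      ... | false | _ = z≤n
      cell v u | no _ | no _ with P v | P u
      ... | true | true = m≤m+n _ _
      ... | true | false = z≤n
      ... | false | _ = z≤n
      row : ∀ v → inner-deg P v ≤
        inner-deg P′ v + (𝟙 (v == x) * inner-deg P x + 𝟙 (P x ∧ P v ∧ adj G x v))
      row v = ≤-trans (∑-mono (cell v)) (≤-reflexive
        (trans (∑-distrib-+ (λ u → 𝟙 (P′ v ∧ P′ u ∧ adj G v u)) _)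
          (cong (inner-deg P′ v +_)
            (trans (∑-distrib-+ (λ u → 𝟙 (v == x) * 𝟙 (P x ∧ P u ∧ adj G x u)) _)
              (cong₂ _+_ (∑-distribˡ-* (𝟙 (v == x)) (λ u → 𝟙 (P x ∧ P u ∧ adj G x u)))
                (trans (∑-distribʳ-* (λ u → 𝟙 (u == x)) c)
                  (trans (cong (_* c) (count-== x)) (+-identityʳ c))))))))
        where c = 𝟙 (P x ∧ P v ∧ adj G x v)

-- Ranking the leaves

transpose₀ : ℕ → ℕ → ℕ
transpose₀ x zero = x
transpose₀ x (suc y) with suc y ℕ.≟ x
... | yes _ = 0
... | no _ = suc y

transpose₀-injective : ∀ x y z → transpose₀ x y ≡ transpose₀ x z → y ≡ z
transpose₀-injective x zero zero eq = refl
transpose₀-injective x zero (suc z) eq with suc z ℕ.≟ x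
... | yes refl = sym eq
... | no q = contradiction (sym eq) q
transpose₀-injective x (suc y) zero eq with suc y ℕ.≟ x
... | yes refl = sym eq
... | no p = contradiction eq p
transpose₀-injective x (suc y) (suc z) eq with suc y ℕ.≟ x | suc z ℕ.≟ x
... | yes p | yes q = trans p (sym q)
... | no p | no q = eq

transpose₀-< : ∀ {m} x y → x ≡ 0 ⊎ x < m → y < m → transpose₀ x y < m
transpose₀-< x zero (inj₁ refl) y<m = y<m
transpose₀-< x zero (inj₂ x<m) y<m = x<m
transpose₀-< x (suc y) _ y<m with suc y ℕ.≟ x
... | yes _ = ≤-trans (s≤s z≤n) y<m
... | no _ = y<m

transpose₀-self : ∀ x → transpose₀ x x ≡ 0
transpose₀-self zero = refl
transpose₀-self (suc x) with suc x ℕ.≟ suc x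
... | yes _ = refl
... | no x≢x = contradiction refl x≢x

split : ∀ {A : Set} → ℕ → (ℕ → A) → (ℕ → A) → ℕ → A
split zero f g r = g r
split (suc k) f g zero = f zero
split (suc k) f g (suc r) = split k (f ∘ suc) g r

split-< : ∀ {A : Set} {k r} {f g : ℕ → A} → r < k → split k f g r ≡ f r
split-< {k = suc k} {zero} r<k = refl
split-< {k = suc k} {suc r} (s≤s r<k) = split-< r<k

split-+ : ∀ {A : Set} k {f g : ℕ → A} j → split k f g (k + j) ≡ g j
split-+ zero j = refl
split-+ (suc k) j = split-+ k j

data Zone : Set where
  low high one big : ℕ → Zone

-- Vertex v owns l v = 2 (k v) + σ v + b v leaves. The first k v of them and the next k v form
-- pairs of ranks x and S − 1 − x, where S is the number of ranks that are not big; a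
-- transposition moves the big rank number x₀ to the front.
module Distribution {n} (k σ b : Fin n → ℕ) (x₀ : ℕ) (x₀-ok : x₀ ≡ 0 ⊎ x₀ < ∑ b) where

  private
    p = ∑ k
    q = ∑ σ

  S : ℕ
  S = p + q + p

  a l : Fin n → ℕ
  a v = k v + (k v + σ v)
  l v = k v + (k v + (σ v + b v))

  zone : Fin n → ℕ → Zone
  zone v = split (k v) (λ j → low (prefix k v + j))
         ( split (k v) (λ j → high (prefix k v + j))
         ( split (σ v) (λ j → one (prefix σ v + j))
                       (λ j → big (prefix b v + j))))

  -- The ranks below `S` are laid out as [0 , p) for low, [p , p + q) for one and [p + q , S) for
  -- high. With the singles in the middle, the reflection x ↦ S - 1 - x carries the low block onto
  -- the high block.
  code : Zone → ℕ
  code (low x) = x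
  code (high x) = S ∸ suc x
  code (one x) = p + x
  code (big x) = S + transpose₀ x₀ x

  leafRank : Fin n → ℕ → ℕ
  leafRank v r = code (zone v r)

  -- Recovers from an index both its zone and its place in that zone, so that injectivity and the
  -- range bounds become finite case analyses.
  data View (v : Fin n) : ℕ → Zone → Set where
    low : ∀ j → j < k v → View v j (low (prefix k v + j))
    high : ∀ j → j < k v → View v (k v + j) (high (prefix k v + j))
    one : ∀ j → j < σ v → View v (k v + (k v + j)) (one (prefix σ v + j))
    big : ∀ j → j < b v → View v (k v + (k v + (σ v + j))) (big (prefix b v + j))

  private
    zone-low : ∀ v j → j < k v → zone v j ≡ low (prefix k v + j)
    zone-low v j = split-<

    zone-high : ∀ v j → j < k v → zone v (k v + j) ≡ high (prefix k v + j)
    zone-high v j j< = trans (split-+ (k v) j) (split-< j<)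

    zone-one : ∀ v j → j < σ v → zone v (k v + (k v + j)) ≡ one (prefix σ v + j)
    zone-one v j j< = trans (split-+ (k v) _) (trans (split-+ (k v) j) (split-< j<))

    zone-big : ∀ v j → zone v (k v + (k v + (σ v + j))) ≡ big (prefix b v + j)
    zone-big v j = trans (split-+ (k v) _) (trans (split-+ (k v) _) (split-+ (σ v) j))

    peel : ∀ m r → m ≤ r → ∃ λ j → r ≡ m + j
    peel m r m≤r = r ∸ m , sym (m+[n∸m]≡n m≤r)

  view : ∀ v r → r < l v → View v r (zone v r)
  view v r r<l with r <? k v
  ... | yes r< = subst (View v r) (sym (zone-low v r r<)) (low r r<)
  ... | no r≮ with peel (k v) r (≮⇒≥ r≮)
  ... | r′ , refl with r′ <? k v
  ... | yes r< = subst (View v _) (sym (zone-high v r′ r<)) (high r′ r<)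
  ... | no r≮ with peel (k v) r′ (≮⇒≥ r≮)
  ... | r″ , refl with r″ <? σ v
  ... | yes r< = subst (View v _) (sym (zone-one v r″ r<)) (one r″ r<)
  ... | no r≮ with peel (σ v) r″ (≮⇒≥ r≮)
  ... | j , refl = subst (View v _) (sym (zone-big v j))
    (big j (+-cancelˡ-< (σ v) _ _ (+-cancelˡ-< (k v) _ _ (+-cancelˡ-< (k v) _ _ r<l))))

  private
    p≤S : p ≤ S
    p≤S = m≤n+m p (p + q)

    pq≤S : p + q ≤ S
    pq≤S = m≤m+n (p + q) p

    low-< : ∀ {v} j → j < k v → prefix k v + j < p
    low-< {v} j = prefix-slot-< k v

    high-≥ : ∀ {v} j → j < k v → p + q ≤ S ∸ suc (prefix k v + j)
    high-≥ j j< = ≤-trans (≤-reflexive (sym (m+n∸n≡m (p + q) p))) (∸-monoʳ-≤ S (low-< j j<))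

    high-< : ∀ {v} j → j < k v → S ∸ suc (prefix k v + j) < S
    high-< j j< = ∸-monoʳ-< (z<s {n = _}) (≤-trans (low-< j j<) p≤S)

    one-< : ∀ {v} j → j < σ v → p + (prefix σ v + j) < p + q
    one-< {v} j j< = +-monoʳ-< p (prefix-slot-< σ v j<)

    apart : ∀ {x y m} {C : Set} → x < m → m ≤ y → x ≡ y → C
    apart x<m m≤y refl = contradiction x<m (≤⇒≯ m≤y)

    view-injective : ∀ {v w r t y z} → View v r y → View w t z → code y ≡ code z → v ≡ w × r ≡ t
    view-injective {v} {w} (low i i<) (low j j<) eq = prefix-slot-injective k v w i< j< eq
    view-injective {v} {w} (high i i<) (high j j<) eq
      with prefix-slot-injective k v w i< j<
             (suc-injective (∸-cancelˡ-≡ (≤-trans (low-< i i<) p≤S) (≤-trans (low-< j j<) p≤S) eq))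
    ... | refl , refl = refl , refl
    view-injective {v} {w} (one i i<) (one j j<) eq
      with prefix-slot-injective σ v w i< j< (+-cancelˡ-≡ p _ _ eq)
    ... | refl , refl = refl , refl
    view-injective {v} {w} (big i i<) (big j j<) eq
      with prefix-slot-injective b v w i< j< (transpose₀-injective x₀ _ _ (+-cancelˡ-≡ S _ _ eq))
    ... | refl , refl = refl , refl
    view-injective (low i i<) (high j j<) = apart (low-< i i<) (≤-trans (m≤m+n p q) (high-≥ j j<))
    view-injective (low i i<) (one j j<) = apart (low-< i i<) (m≤m+n p _)
    view-injective (low i i<) (big j j<) = apart (≤-trans (low-< i i<) p≤S) (m≤m+n S _)
    view-injective (high i i<) (low j j<) eq =
      apart (low-< j j<) (≤-trans (m≤m+n p q) (high-≥ i i<)) (sym eq)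
    view-injective (high i i<) (one j j<) eq = apart (one-< j j<) (high-≥ i i<) (sym eq)
    view-injective (high i i<) (big j j<) = apart (high-< i i<) (m≤m+n S _)
    view-injective (one i i<) (low j j<) eq = apart (low-< j j<) (m≤m+n p _) (sym eq)
    view-injective (one i i<) (high j j<) = apart (one-< i i<) (high-≥ j j<)
    view-injective (one i i<) (big j j<) = apart (≤-trans (one-< i i<) pq≤S) (m≤m+n S _)
    view-injective (big i i<) (low j j<) eq = apart (≤-trans (low-< j j<) p≤S) (m≤m+n S _) (sym eq)
    view-injective (big i i<) (high j j<) eq = apart (high-< j j<) (m≤m+n S _) (sym eq)
    view-injective (big i i<) (one j j<) eq = apart (≤-trans (one-< j j<) pq≤S) (m≤m+n S _) (sym eq)

  leafRank-injective : ∀ v w {r t} → r < l v → t < l w → leafRank v r ≡ leafRank w t → v ≡ w × r ≡ t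
  leafRank-injective v w {r} {t} r< t< = view-injective (view v r r<) (view w t t<)

  leafRank-< : ∀ v r → r < l v → leafRank v r < S + ∑ b
  leafRank-< v r r< with zone v r | view v r r<
  ... | _ | low j j< = ≤-trans (≤-trans (low-< j j<) p≤S) (m≤m+n S _)
  ... | _ | high j j< = ≤-trans (high-< j j<) (m≤m+n S _)
  ... | _ | one j j< = ≤-trans (≤-trans (one-< j j<) pq≤S) (m≤m+n S _)
  ... | _ | big j j< = +-monoʳ-< S (transpose₀-< x₀ _ x₀-ok (prefix-slot-< b v j<))

  private
    big-≥ : ∀ v j → a v ≤ k v + (k v + (σ v + j))
    big-≥ v j = +-monoʳ-≤ (k v) (+-monoʳ-≤ (k v) (m≤m+n (σ v) j))

  small-leafRank : ∀ v r → r < l v → r < a v → leafRank v r < S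
  small-leafRank v r r< r<a with zone v r | view v r r<
  ... | _ | low j j< = ≤-trans (low-< j j<) p≤S
  ... | _ | high j j< = high-< j j<
  ... | _ | one j j< = ≤-trans (one-< j j<) pq≤S
  ... | _ | big j j< = contradiction r<a (≤⇒≯ (big-≥ v j))

  big-leafRank : ∀ v r → r < l v → a v ≤ r → S ≤ leafRank v r
  big-leafRank v r r< a≤r with zone v r | view v r r<
  ... | _ | big j j< = m≤m+n S _
  ... | _ | low j j< = contradiction (≤-trans j< (m≤m+n _ _)) (≤⇒≯ a≤r)
  ... | _ | high j j< = contradiction (+-monoʳ-< (k v) (≤-trans j< (m≤m+n _ _))) (≤⇒≯ a≤r)
  ... | _ | one j j< = contradiction (+-monoʳ-< (k v) (+-monoʳ-< (k v) j<)) (≤⇒≯ a≤r)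

  first-big-leafRank : ∀ v r → r ≡ a v → prefix b v ≡ x₀ → leafRank v r ≡ S
  first-big-leafRank v r refl eq = begin
    code (zone v (k v + (k v + σ v)))
      ≡⟨ cong (λ t → code (zone v (k v + (k v + t)))) (+-identityʳ (σ v)) ⟨
    code (zone v (k v + (k v + (σ v + 0))))
      ≡⟨ cong code (zone-big v 0) ⟩
    S + transpose₀ x₀ (prefix b v + 0)
      ≡⟨ cong (λ t → S + transpose₀ x₀ t) (trans (+-identityʳ _) eq) ⟩
    S + transpose₀ x₀ x₀
      ≡⟨ cong (S +_) (transpose₀-self x₀) ⟩
    S + 0
      ≡⟨ +-identityʳ S ⟩
    S ∎
    where open ≡-Reasoning

  -- The edge label, rank plus one, of the unpaired small leaf of `v`; it has this meaning only when
  -- `σ v` is 1.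
  single : Fin n → ℕ
  single v = suc (p + prefix σ v)

  single-≤ : ∀ v → σ v ≡ 1 → single v ≤ S
  single-≤ v eq = ≤-trans (subst (λ t → suc (p + t) ≤ p + q) (+-identityʳ _)
    (one-< 0 (≤-reflexive (sym eq)))) pq≤S

  single-injective : ∀ v w → σ v ≡ 1 → σ w ≡ 1 → single v ≡ single w → v ≡ w
  single-injective v w σv σw eq = proj₁ (prefix-slot-injective σ v w
    (≤-reflexive (sym σv)) (≤-reflexive (sym σw)) (cong (_+ 0) (+-cancelˡ-≡ p _ _ (suc-injective eq))))

  -- The two edges of a pair contribute (x + 1) + (S − x) = S + 1.
  ∑-leafRank : ∀ v → σ v ≤ 1 →
    ∑< (l v) (λ r → suc S ⊓ suc (leafRank v r)) ≡ (k v + b v) * suc S + σ v * single v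
  ∑-leafRank v σ≤1 = begin
    ∑< (l v) F
      ≡⟨ ∑<-+ (k v) _ F ⟩
    ∑< (k v) F + ∑< (k v + (σ v + b v)) (λ j → F (k v + j))
      ≡⟨ cong (∑< (k v) F +_) (∑<-+ (k v) _ _) ⟩
    ∑< (k v) F + (∑< (k v) (λ j → F (k v + j)) + ∑< (σ v + b v) (λ j → F (k v + (k v + j))))
      ≡⟨ +-assoc (∑< (k v) F) _ _ ⟨
    ∑< (k v) F + ∑< (k v) (λ j → F (k v + j)) + ∑< (σ v + b v) (λ j → F (k v + (k v + j)))
      ≡⟨ cong₂ _+_ pairs (∑<-+ (σ v) _ _) ⟩
    k v * suc S + (∑< (σ v) (λ j → F (k v + (k v + j))) + ∑< (b v) (λ j → F (k v + (k v + (σ v + j)))))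
      ≡⟨ cong (k v * suc S +_) (cong₂ _+_ singles bigs) ⟩
    k v * suc S + (σ v * single v + b v * suc S)
      ≡⟨ regroup (k v) (b v) (suc S) (σ v * single v) ⟩
    (k v + b v) * suc S + σ v * single v ∎
    where
    open ≡-Reasoning
    F : ℕ → ℕ
    F r = suc S ⊓ suc (leafRank v r)
    regroup : ∀ k b s x → k * s + (x + b * s) ≡ (k + b) * s + x
    regroup = solve-∀
    F-small : ∀ {r x} → leafRank v r ≡ x → x < S → F r ≡ suc x
    F-small refl x<S = m≥n⇒m⊓n≡n (s≤s (<⇒≤ x<S))
    pair : ∀ j → j < k v → F j + F (k v + j) ≡ suc S
    pair j j< = begin
      F j + F (k v + j)
        ≡⟨ cong₂ _+_ (F-small (cong code (zone-low v j j<)) (≤-trans (low-< j j<) p≤S))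
                     (F-small (cong code (zone-high v j j<)) (high-< j j<)) ⟩
      suc x + suc (S ∸ suc x)
        ≡⟨ +-suc (suc x) _ ⟩
      suc (suc x + (S ∸ suc x))
        ≡⟨ cong suc (m+[n∸m]≡n (≤-trans (low-< j j<) p≤S)) ⟩
      suc S ∎
      where x = prefix k v + j
    pairs : ∑< (k v) F + ∑< (k v) (λ j → F (k v + j)) ≡ k v * suc S
    pairs = trans (∑<-distrib-+ (k v) F _) (trans (∑<-cong (k v) pair) (∑<-const (k v) (suc S)))
    single-value : ∀ j → j < σ v → F (k v + (k v + j)) ≡ single v
    single-value zero j< = trans (F-small (cong code (zone-one v 0 j<)) (≤-trans (one-< 0 j<) pq≤S))
      (cong (λ t → suc (p + t)) (+-identityʳ _))
    single-value (suc j) j< = contradiction (≤-trans j< σ≤1) (λ { (s≤s ()) })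
    singles : ∑< (σ v) (λ j → F (k v + (k v + j))) ≡ σ v * single v
    singles = trans (∑<-cong (σ v) single-value) (∑<-const (σ v) (single v))
    big-value : ∀ j → F (k v + (k v + (σ v + j))) ≡ suc S
    big-value j = m≤n⇒m⊓n≡m (s≤s (≤-trans (m≤m+n S _) (≤-reflexive (sym (cong code (zone-big v j))))))
    bigs : ∑< (b v) (λ j → F (k v + (k v + (σ v + j)))) ≡ b v * suc S
    bigs = trans (∑<-cong (b v) (λ j _ → big-value j)) (∑<-const (b v) (suc S))

-- Leaves and their owners

count-≤1⇒unique : ∀ {n} (P : Fin n → Bool) → count P ≤ 1 → ∀ {i j} → P i ≡ true → P j ≡ true → i ≡ j
count-≤1⇒unique P le {i} {j} pi pj with i ≟ j
... | yes eq = eq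
... | no i≢j = contradiction (≤-trans two le) (λ { (s≤s ()) })
  where
  pointwise : ∀ x → 𝟙 (x == i) + 𝟙 (x == j) ≤ 𝟙 (P x)
  pointwise x with x ≟ i | x ≟ j
  ... | yes refl | yes refl = contradiction refl i≢j
  ... | yes refl | no _ = 1≤𝟙 pi
  ... | no _ | yes refl = 1≤𝟙 pj
  ... | no _ | no _ = z≤n
  two : 2 ≤ count P
  two = subst (_≤ count P)
    (trans (∑-distrib-+ (λ x → 𝟙 (x == i)) _) (cong₂ _+_ (count-== i) (count-== j)))
    (∑-mono pointwise)

<ᵇ-true⇒< : ∀ {m n} → (m <ᵇ n) ≡ true → m < n
<ᵇ-true⇒< {m} {n} h = <ᵇ⇒< m n (Equivalence.from T-≡ h)

<ᵇ-false⇒≥ : ∀ {m n} → (m <ᵇ n) ≡ false → n ≤ m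
<ᵇ-false⇒≥ h = ≮⇒≥ (λ lt → subst T h (<⇒<ᵇ lt))

<⇒<ᵇ-true : ∀ {m n} → m < n → (m <ᵇ n) ≡ true
<⇒<ᵇ-true lt = Equivalence.to T-≡ (<⇒<ᵇ lt)

module Leaves (G : Graph) (no-isolated : ∀ v → deg G v ≢ 0) where

  V : Set
  V = Fin (n G)

  leaf : V → Bool
  leaf v = deg G v ≡ᵇ 1

  nonleaf : V → Bool
  nonleaf v = not (leaf v)

  nonleaf⇒ : ∀ {v} → nonleaf v ≡ true → leaf v ≡ false
  nonleaf⇒ {v} h with leaf v
  ... | false = refl

  leaf⇒deg≡1 : ∀ v → leaf v ≡ true → deg G v ≡ 1
  leaf⇒deg≡1 v = ≡ᵇ-true⇒≡

  nonleaf⇒deg≥2 : ∀ v → leaf v ≡ false → 2 ≤ deg G v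
  nonleaf⇒deg≥2 v h with deg G v in eq
  ... | zero = contradiction eq (no-isolated v)
  ... | suc (suc _) = s≤s (s≤s z≤n)

  abstract
    nb : V → V
    nb v = proj₁ (count>0⇒∃ (adj G v) (n≢0⇒n>0 (no-isolated v)))

    nb-adj : ∀ v → Adj G v (nb v)
    nb-adj v = proj₂ (count>0⇒∃ (adj G v) (n≢0⇒n>0 (no-isolated v)))

  nb-unique : ∀ u {w} → leaf u ≡ true → Adj G u w → w ≡ nb u
  nb-unique u lu uw = count-≤1⇒unique (adj G u) (≤-reflexive (leaf⇒deg≡1 u lu)) uw (nb-adj u)

  ∑-leaf-edges : ∀ u → leaf u ≡ true → (f : V → ℕ)
    → ∑ (λ w → if adj G u w then f w else 0) ≡ f (nb u)
  ∑-leaf-edges u lu f = trans (∑-single _ (nb u) off) (cong (λ x → if x then f (nb u) else 0) (nb-adj u))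
    where
    off : ∀ w → w ≢ nb u → (if adj G u w then f w else 0) ≡ 0
    off w w≢ with adj G u w in uw
    ... | false = refl
    ... | true = contradiction (nb-unique u lu uw) w≢

  -- The leaves of an isolated edge are both owned by the smaller one.
  owner : V → V
  owner u = if leaf (nb u) then (if toℕ (nb u) <ᵇ toℕ u then nb u else u) else nb u

  owner-nonleaf-nb : ∀ u → leaf (nb u) ≡ false → owner u ≡ nb u
  owner-nonleaf-nb u h rewrite h = refl

  owner-leaf-nb : ∀ u → leaf (nb u) ≡ true → owner u ≡ nb u ⊎ owner u ≡ u
  owner-leaf-nb u h rewrite h with toℕ (nb u) <ᵇ toℕ u
  ... | true = inj₁ refl
  ... | false = inj₂ refl

  owner-pair : ∀ u w → leaf u ≡ true → leaf w ≡ true → Adj G u w → owner u ≡ owner w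
  owner-pair u w lu lw uw = go (nb-unique u lu uw) (nb-unique w lw (adj-sym G uw))
    where
    go : w ≡ nb u → u ≡ nb w → owner u ≡ owner w
    go eq eq′ rewrite sym eq | sym eq′ | lu | lw with toℕ w <ᵇ toℕ u in p | toℕ u <ᵇ toℕ w in q
    ... | true | true = contradiction (<ᵇ-true⇒< {toℕ w} p) (<-asym (<ᵇ-true⇒< {toℕ u} q))
    ... | true | false = refl
    ... | false | true = refl
    ... | false | false = toℕ-injective (≤-antisym (<ᵇ-false⇒≥ p) (<ᵇ-false⇒≥ q))

  owns : V → V → Bool
  owns v u = leaf u ∧ (owner u == v)

  owns-owner : ∀ u → leaf u ≡ true → owns (owner u) u ≡ true
  owns-owner u lu rewrite lu = ==-refl (owner u)

  -- At an inner vertex these are its leaf neighbours. A leaf owns leaves only as the smaller end of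
  -- an isolated edge, which then behaves like a vertex with two leaves.
  l : V → ℕ
  l v = count (owns v)

  leafIndex : V → ℕ
  leafIndex u = rank (owns (owner u)) u

  leafIndex-< : ∀ u → leaf u ≡ true → leafIndex u < l (owner u)
  leafIndex-< u lu = rank-<-count (owns (owner u)) u (owns-owner u lu)

  leafIndex-injective : ∀ u w → leaf u ≡ true → leaf w ≡ true
    → owner u ≡ owner w → leafIndex u ≡ leafIndex w → u ≡ w
  leafIndex-injective u w lu lw eq = go (owner u) refl (owner w) refl eq
    where
    go : ∀ x → owner u ≡ x → ∀ y → owner w ≡ y → x ≡ y → rank (owns x) u ≡ rank (owns y) w → u ≡ w
    go x refl y eq′ refl = rank-injective (owns x) u w (owns-owner u lu)
      (subst (λ z → owns z w ≡ true) eq′ (owns-owner w lw))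

  ∑l≡n₁ : ∑ l ≡ n₁ G
  ∑l≡n₁ = trans (∑-comm (λ v u → 𝟙 (owns v u))) (∑-cong column)
    where
    column : ∀ u → ∑ (λ v → 𝟙 (owns v u)) ≡ 𝟙 (leaf u)
    column u with leaf u
    ... | false = ∑-zero {n G} (λ _ → refl)
    ... | true = trans (∑-cong flip) (count-== (owner u))
      where
      flip : ∀ v → 𝟙 (owner u == v) ≡ 𝟙 (v == owner u)
      flip v with owner u ≟ v | v ≟ owner u
      ... | yes _ | yes _ = refl
      ... | no _ | no _ = refl
      ... | yes p | no q = contradiction (sym p) q
      ... | no p | yes q = contradiction (sym q) p

  nonleaf-owns : ∀ v → leaf v ≡ false → ∀ u → owns v u ≡ leaf u ∧ adj G v u
  nonleaf-owns v nlv u with leaf u in lu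
  ... | false = refl
  ... | true with leaf (nb u) in lnb
  ... | true = trans (dec-false (_ ≟ v) not-owner) (sym not-adj)
    where
    not-nb : nb u ≢ v
    not-nb refl = contradiction (trans (sym nlv) lnb) (λ ())
    not-owner : (if toℕ (nb u) <ᵇ toℕ u then nb u else u) ≢ v
    not-owner with toℕ (nb u) <ᵇ toℕ u
    ... | true = not-nb
    ... | false = λ { refl → contradiction (trans (sym nlv) lu) (λ ()) }
    not-adj : adj G v u ≡ false
    not-adj with adj G v u in vu
    ... | false = refl
    ... | true = contradiction (sym (nb-unique u lu (adj-sym G vu))) not-nb
  ... | false with nb u ≟ v
  ... | yes refl = sym (adj-sym G (nb-adj u))
  ... | no nb≢v with adj G v u in vu
  ... | false = refl
  ... | true = contradiction (sym (nb-unique u lu (adj-sym G vu))) nb≢v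

  -- Ownership by a leaf comes only from an isolated edge, so nothing but `v` and its unique
  -- neighbour qualifies.
  l-leaf-≤2 : ∀ v → leaf v ≡ true → l v ≤ 2
  l-leaf-≤2 v lv = ≤-trans (∑-mono pointwise) (≤-reflexive
    (trans (∑-distrib-+ (λ x → 𝟙 (x == v)) _) (cong₂ _+_ (count-== v) (count-== (nb v)))))
    where
    at-nb : ∀ x → nb x ≡ v → x ≡ nb v
    at-nb x refl = nb-unique v lv (adj-sym G (nb-adj x))
    owned : ∀ x → owns v x ≡ true → x ≡ v ⊎ x ≡ nb v
    owned x h = by-nb (leaf (nb x)) refl
      where
      owner≡v : owner x ≡ v
      owner≡v = ==⇒≡ (proj₂ (∧-true {leaf x} h))
      by-nb : ∀ t → leaf (nb x) ≡ t → x ≡ v ⊎ x ≡ nb v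
      by-nb false lnb = contradiction
        (trans (sym lv) (trans (cong leaf (trans (sym owner≡v) (owner-nonleaf-nb x lnb))) lnb)) (λ ())
      by-nb true lnb with owner-leaf-nb x lnb
      ... | inj₁ eq = inj₂ (at-nb x (trans (sym eq) owner≡v))
      ... | inj₂ eq = inj₁ (trans (sym eq) owner≡v)
    pointwise : ∀ x → 𝟙 (owns v x) ≤ 𝟙 (x == v) + 𝟙 (x == nb v)
    pointwise x with owns v x in h
    ... | false = z≤n
    ... | true with owned x h
    ... | inj₁ refl rewrite ==-refl x = s≤s z≤n
    ... | inj₂ refl rewrite ==-refl (nb v) = m≤n+m 1 _

  c : V → ℕ
  c v = count (λ u → nonleaf u ∧ adj G v u)

  deg≡c+l : ∀ v → leaf v ≡ false → deg G v ≡ c v + l v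
  deg≡c+l v nlv = trans (∑-cong pointwise) (∑-distrib-+ (λ u → 𝟙 (nonleaf u ∧ adj G v u)) _)
    where
    pointwise : ∀ u → 𝟙 (adj G v u) ≡ 𝟙 (nonleaf u ∧ adj G v u) + 𝟙 (owns v u)
    pointwise u rewrite nonleaf-owns v nlv u with leaf u
    ... | true = refl
    ... | false = sym (+-identityʳ _)

-- The weighting

parity : ℕ → ℕ
parity zero = 0
parity (suc zero) = 1
parity (suc (suc m)) = parity m

parity≤1 : ∀ m → parity m ≤ 1
parity≤1 zero = z≤n
parity≤1 (suc zero) = ≤-refl
parity≤1 (suc (suc m)) = parity≤1 m

half+parity : ∀ m → ⌈ m /2⌉ ≡ ⌊ m /2⌋ + parity m
half+parity zero = refl
half+parity (suc zero) = refl
half+parity (suc (suc m)) = cong suc (half+parity m)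

halves : ∀ m → ⌊ m /2⌋ + (⌊ m /2⌋ + parity m) ≡ m
halves m = trans (cong (⌊ m /2⌋ +_) (sym (half+parity m))) (⌊n/2⌋+⌈n/2⌉≡n m)

step-below : ∀ s q q′ {r r′} → r < s → q < q′ → q * s + r < q′ * s + r′
step-below s q q′ {r} r<s q<q′ =
  <-≤-trans (subst (q * s + r <_) (+-comm (q * s) s) (+-monoʳ-< (q * s) r<s))
    (≤-trans (*-monoˡ-≤ s q<q′) (m≤m+n (q′ * s) _))

quotient-unique : ∀ s q q′ {r r′} → r < s → r′ < s → q * s + r ≡ q′ * s + r′ → q ≡ q′
quotient-unique s q q′ {r} {r′} r< r′< eq with <-cmp q q′
... | tri≈ _ q≡q′ _ = q≡q′
... | tri< q<q′ _ _ = contradiction eq (<⇒≢ (step-below s q q′ r< q<q′))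
... | tri> _ _ q′<q = contradiction (sym eq) (<⇒≢ (step-below s q′ q r′< q′<q))

-- With `t * s + y` the sum of the edges at a vertex, the target weight `t * s + f + 1` requires a
-- vertex label between 1 and `s` exactly when `f` is neither below `y` nor `s` or more above it.
window : ∀ s t y f → y ≤ f → suc f ≤ y + s
  → suc (t * s + y) ≤ suc (t * s + f) × suc (t * s + f) ≤ t * s + y + s
window s t y f y≤f f<y+s = s≤s (+-monoʳ-≤ (t * s) y≤f)
  , subst₂ _≤_ (+-suc (t * s) f) (sym (+-assoc (t * s) y s)) (+-monoʳ-≤ (t * s) f<y+s)

-- A vertex of degree 2 has edge sum 2s, or s + x when one of its leaves is small. The weight 2s + 1
-- is within reach of both, since x lies between 1 and s.
window-2 : ∀ s t σ x → t + σ ≡ 2 → σ ≤ 1 → 1 ≤ x → (σ ≡ 1 → x ≤ s) → 1 ≤ s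
  → suc (t * s + σ * x) ≤ suc ((2 ⊔ t) * s + 0) × suc ((2 ⊔ t) * s + 0) ≤ t * s + σ * x + s
window-2 s (suc (suc zero)) zero x _ _ _ _ 1≤s = window s 2 0 0 z≤n 1≤s
window-2 s (suc zero) (suc zero) x _ _ 1≤x x≤s _ =
    lin 0 (x≤s refl) (upper s x)
  , lin 0 1≤x (lower s x)
  where
  upper : ∀ s x → suc (1 * s + 1 * x) + s + 0 ≡ suc (2 * s + 0) + x
  upper = solve-∀
  lower : ∀ s x → suc (2 * s + 0) + x + 0 ≡ 1 * s + 1 * x + s + 1
  lower = solve-∀
window-2 s t (suc (suc σ)) x _ (s≤s ()) _ _ _
window-2 s zero zero x () _ _ _ _
window-2 s (suc zero) zero x () _ _ _ _
window-2 s (suc (suc (suc t))) zero x () _ _ _ _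
window-2 s zero (suc zero) x () _ _ _ _
window-2 s (suc (suc t)) (suc zero) x eq _ _ _ _ =
  contradiction (trans (+-comm 1 t) (suc-injective (suc-injective eq))) (λ ())

-- From a distribution of the small leaves to an irregular weighting

module Construction (G : Graph) (no-isolated : ∀ v → deg G v ≢ 0)
  (one-deg-2 : ∀ u v → deg G u ≡ 2 → deg G v ≡ 2 → u ≡ v) where

  open Leaves G no-isolated

  -- The window number t, with a floor at 2 for the vertex of degree 2: one small leaf there gives t
  -- = 1, a window that overlaps the leaf weights.
  level : (V → ℕ) → V → ℕ
  level a v = 2 ⊔ (deg G v ∸ ⌈ a v /2⌉)

  -- All that the weighting asks of the numbers of small leaves. `n₁-bound` keeps the leaf weights
  -- at most 2s; `room` leaves each inner vertex an edge that is not at a small leaf, which gives t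
  -- ≥ 2 beyond degree 2; `one-mixed` allows one isolated edge with a small and a big end; `few` is
  -- the capacity of the windows.
  record Plan (a : V → ℕ) : Set where
    field
      a≤l : ∀ v → a v ≤ l v
      n₁-bound : n₁ G ≤ suc (∑ a + ∑ a)
      room : ∀ v → leaf v ≡ false → suc (a v) ≤ deg G v
      one-mixed : ∀ v w → leaf v ≡ true → leaf w ≡ true → a v ≡ 1 → a w ≡ 1
        → a v < l v → a w < l w → v ≡ w
      few : ∀ t → count (λ v → nonleaf v ∧ (level a v ≡ᵇ t)) ≤ suc (∑ a)

  module Weighting (a : V → ℕ) (plan : Plan a) where
    open Plan plan

    k σ b : V → ℕ
    k v = ⌊ a v /2⌋
    σ v = parity (a v)
    b v = l v ∸ a v

    mixed : V → Bool
    mixed v = leaf v ∧ ((a v ≡ᵇ 1) ∧ (a v <ᵇ l v))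

    first-mixed : ∃ λ x₀ → (x₀ ≡ 0 ⊎ x₀ < ∑ b) × (∀ v → mixed v ≡ true → prefix b v ≡ x₀)
    first-mixed with ∃-true? mixed
    -- With `x₀` equal to 0 the transposition is the identity; this must also be allowed when there
    -- are no big leaves.
    ... | no none = 0 , inj₁ refl , λ v h → contradiction (v , h) none
    -- The slot of the first big leaf of the mixed isolated edge, which the transposition sends to
    -- rank `S`.
    ... | yes (w , hw) = prefix b w
      , inj₂ (subst (_< ∑ b) (+-identityʳ _) (prefix-slot-< b w (m<n⇒0<n∸m (a<l w hw))))
      , λ v hv → cong (prefix b) (one-mixed v w (is-leaf v hv) (is-leaf w hw)
          (a≡1 v hv) (a≡1 w hw) (a<l v hv) (a<l w hw))
      where
      is-leaf : ∀ v → mixed v ≡ true → leaf v ≡ true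
      is-leaf v h = proj₁ (∧-true h)
      a≡1 : ∀ v → mixed v ≡ true → a v ≡ 1
      a≡1 v h = ≡ᵇ-true⇒≡ (proj₁ (∧-true (proj₂ (∧-true {leaf v} h))))
      a<l : ∀ v → mixed v ≡ true → a v < l v
      a<l v h = <ᵇ-true⇒< (proj₂ (∧-true {a v ≡ᵇ 1} (proj₂ (∧-true {leaf v} h))))

    module D = Distribution k σ b (proj₁ first-mixed) (proj₁ (proj₂ first-mixed))
    open D using (S)

    D-a : ∀ v → D.a v ≡ a v
    D-a v = halves (a v)

    D-l : ∀ v → D.l v ≡ l v
    D-l v = trans (trans (regroup (k v) (σ v) (b v)) (cong (_+ b v) (D-a v))) (m+[n∸m]≡n (a≤l v))
      where
      regroup : ∀ k σ b → k + (k + (σ + b)) ≡ k + (k + σ) + b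
      regroup = solve-∀

    S≡∑a : S ≡ ∑ a
    S≡∑a = trans (regroup (∑ k) (∑ σ)) (sym (trans (∑-cong (sym ∘ D-a))
      (trans (∑-distrib-+ k _) (cong (∑ k +_) (∑-distrib-+ k σ)))))
      where
      regroup : ∀ k σ → k + σ + k ≡ k + (k + σ)
      regroup = solve-∀

    n₁≡S+∑b : n₁ G ≡ S + ∑ b
    n₁≡S+∑b = trans (sym ∑l≡n₁) (trans (∑-cong (λ v → sym (m+[n∸m]≡n (a≤l v))))
      (trans (∑-distrib-+ a b) (cong (_+ ∑ b) (sym S≡∑a))))

    s : ℕ
    s = suc S

    ρ : V → ℕ
    ρ u = D.leafRank (owner u) (leafIndex u)

    index-< : ∀ u → leaf u ≡ true → leafIndex u < D.l (owner u)
    index-< u lu = subst (leafIndex u <_) (sym (D-l (owner u))) (leafIndex-< u lu)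

    ρ-injective : ∀ u w → leaf u ≡ true → leaf w ≡ true → ρ u ≡ ρ w → u ≡ w
    ρ-injective u w lu lw eq =
      let (o , i) = D.leafRank-injective (owner u) (owner w) (index-< u lu) (index-< w lw) eq
      in leafIndex-injective u w lu lw o i

    ρ-≤ : ∀ u → leaf u ≡ true → ρ u ≤ S + S
    ρ-≤ u lu = ≤-pred (≤-trans (D.leafRank-< (owner u) (leafIndex u) (index-< u lu))
      (subst₂ _≤_ n₁≡S+∑b (cong (λ t → suc (t + t)) (sym S≡∑a)) n₁-bound))

    ρ-small : ∀ u → leaf u ≡ true → leafIndex u < a (owner u) → ρ u < S
    ρ-small u lu i<a = D.small-leafRank (owner u) _ (index-< u lu)
      (subst (leafIndex u <_) (sym (D-a (owner u))) i<a)

    ρ-big : ∀ u → leaf u ≡ true → a (owner u) ≤ leafIndex u → S ≤ ρ u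
    ρ-big u lu a≤i = D.big-leafRank (owner u) _ (index-< u lu)
      (subst (_≤ leafIndex u) (sym (D-a (owner u))) a≤i)

    leaf-owner : ∀ u w → leaf u ≡ true → leaf w ≡ true → Adj G u w → leaf (owner u) ≡ true
    leaf-owner u w lu lw uw with owner-leaf-nb u (trans (cong leaf (sym (nb-unique u lu uw))) lw)
    ... | inj₁ eq = trans (cong leaf (trans eq (sym (nb-unique u lu uw)))) lw
    ... | inj₂ eq = trans (cong leaf eq) lu

    -- Clear if `u` is small. If both ends are big, their ranks lie between `S` and 2S. If only `u`
    -- is big, the edge is the mixed one and the rank of `u` was arranged to be exactly `S`.
    ρ-pair : ∀ u w → leaf u ≡ true → leaf w ≡ true → Adj G u w → ρ u ≤ ρ w + S
    ρ-pair u w lu lw uw with leafIndex u <? a (owner u)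
    ... | yes small = ≤-trans (<⇒≤ (ρ-small u lu small)) (m≤n+m S (ρ w))
    ... | no late = by-a (a (owner u)) refl
      where
      o = owner u
      lo : leaf o ≡ true
      lo = leaf-owner u w lu lw uw
      i<2 : leafIndex u < 2
      i<2 = ≤-trans (leafIndex-< u lu) (l-leaf-≤2 o lo)
      by-a : ∀ m → a o ≡ m → ρ u ≤ ρ w + S
      by-a zero a≡ = ≤-trans (ρ-≤ u lu) (+-monoˡ-≤ S (ρ-big w lw
        (subst (_≤ leafIndex w) (trans (sym a≡) (cong a (owner-pair u w lu lw uw))) z≤n)))
      by-a (suc zero) a≡ = ≤-trans (≤-reflexive at-S) (m≤n+m S (ρ w))
        where
        i≡1 : leafIndex u ≡ 1
        i≡1 = ≤-antisym (≤-pred i<2) (subst (_≤ leafIndex u) a≡ (≮⇒≥ late))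
        is-mixed : mixed o ≡ true
        is-mixed = ∧-intro lo (∧-intro (≡⇒≡ᵇ-true a≡)
          (<⇒<ᵇ-true (subst (_< l o) (trans i≡1 (sym a≡)) (leafIndex-< u lu))))
        at-S : ρ u ≡ S
        at-S = D.first-big-leafRank o _ (trans i≡1 (sym (trans (D-a o) a≡)))
          (proj₂ (proj₂ first-mixed) o is-mixed)
      by-a (suc (suc m)) a≡ = contradiction (≤-trans i<2 (subst (2 ≤_) (sym a≡) (s≤s (s≤s z≤n)))) late

    -- An upper limit that each vertex sets for its edges. Taking the minimum over the two ends
    -- gives a symmetric label and covers inner, pendant and isolated edges at once.
    h : V → ℕ
    h u = if leaf u then s ⊓ suc (ρ u) else s

    h-leaf : ∀ u → leaf u ≡ true → h u ≡ s ⊓ suc (ρ u)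
    h-leaf u lu rewrite lu = refl

    h-nonleaf : ∀ u → leaf u ≡ false → h u ≡ s
    h-nonleaf u nlu rewrite nlu = refl

    h≤s : ∀ u → h u ≤ s
    h≤s u with leaf u
    ... | true = m⊓n≤m s _
    ... | false = ≤-refl

    1≤h : ∀ u → 1 ≤ h u
    1≤h u with leaf u
    ... | true = s≤s z≤n
    ... | false = s≤s z≤n

    e : V → V → ℕ
    e u w = h u ⊓ h w

    W : V → ℕ
    W v = ∑ (λ u → if adj G v u then e v u else 0)

    W-leaf : ∀ u → leaf u ≡ true → W u ≡ e u (nb u)
    W-leaf u lu = ∑-leaf-edges u lu (e u)

    W-leaf-≤ : ∀ u → leaf u ≡ true → W u ≤ suc (ρ u)
    W-leaf-≤ u lu = subst (_≤ suc (ρ u)) (sym (W-leaf u lu)) (≤-trans (m⊓n≤m (h u) _)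
      (subst (_≤ suc (ρ u)) (sym (h-leaf u lu)) (m⊓n≤n s _)))

    -- The edge label is a minimum, so each competing value must be large enough. The value s
    -- suffices because ranks are at most 2S; the value set by a neighbouring leaf suffices by
    -- `ρ-pair`.
    W-leaf-≥ : ∀ u → leaf u ≡ true → suc (suc (ρ u)) ≤ W u + s
    W-leaf-≥ u lu = subst (λ t → suc (suc (ρ u)) ≤ t + s) (sym (W-leaf u lu))
      (glb (h u) (h (nb u))
        (subst (λ t → suc (suc (ρ u)) ≤ t + s) (sym (h-leaf u lu))
          (glb s (suc (ρ u)) below-2s (s≤s (≤-trans (s≤s (m≤m+n (ρ u) S)) (≤-reflexive (sym (+-suc (ρ u) S)))))))
        (other (leaf (nb u)) refl))
      where
      glb : ∀ x y → suc (suc (ρ u)) ≤ x + s → suc (suc (ρ u)) ≤ y + s → suc (suc (ρ u)) ≤ x ⊓ y + s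
      glb x y p q = subst (suc (suc (ρ u)) ≤_) (sym (+-distribʳ-⊓ s x y)) (⊓-glb p q)
      below-2s : suc (suc (ρ u)) ≤ s + s
      below-2s = s≤s (≤-trans (s≤s (ρ-≤ u lu)) (≤-reflexive (sym (+-suc S S))))
      other : ∀ t → leaf (nb u) ≡ t → suc (suc (ρ u)) ≤ h (nb u) + s
      other false nl = subst (λ t → suc (suc (ρ u)) ≤ t + s) (sym (h-nonleaf (nb u) nl)) below-2s
      other true lw = subst (λ t → suc (suc (ρ u)) ≤ t + s) (sym (h-leaf (nb u) lw))
        (glb s (suc (ρ (nb u))) below-2s (s≤s (≤-trans (s≤s (ρ-pair u (nb u) lu lw (nb-adj u)))
          (≤-reflexive (sym (+-suc (ρ (nb u)) S))))))

    -- Edges to inner neighbours carry s each; the edges to leaves are summed by index, where the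
    -- pairs collapse to multiples of s.
    W-nonleaf : ∀ v → leaf v ≡ false → W v ≡ (c v + (k v + b v)) * s + σ v * D.single v
    W-nonleaf v nlv = begin
      W v
        ≡⟨ ∑-cong pointwise ⟩
      ∑ (λ u → 𝟙 (nonleaf u ∧ adj G v u) * s + (if owns v u then F (rank (owns v) u) else 0))
        ≡⟨ ∑-distrib-+ (λ u → 𝟙 (nonleaf u ∧ adj G v u) * s) _ ⟩
      ∑ (λ u → 𝟙 (nonleaf u ∧ adj G v u) * s) + ∑ (λ u → if owns v u then F (rank (owns v) u) else 0)
        ≡⟨ cong₂ _+_ (∑-distribʳ-* (λ u → 𝟙 (nonleaf u ∧ adj G v u)) s) (∑-by-rank (owns v) F) ⟩
      c v * s + ∑< (l v) F
        ≡⟨ cong (λ t → c v * s + ∑< t F) (D-l v) ⟨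
      c v * s + ∑< (D.l v) F
        ≡⟨ cong (c v * s +_) (D.∑-leafRank v (parity≤1 (a v))) ⟩
      c v * s + ((k v + b v) * s + σ v * D.single v)
        ≡⟨ regroup (c v) (k v + b v) s (σ v * D.single v) ⟩
      (c v + (k v + b v)) * s + σ v * D.single v ∎
      where
      open ≡-Reasoning
      regroup : ∀ c t s x → c * s + (t * s + x) ≡ (c + t) * s + x
      regroup = solve-∀
      F : ℕ → ℕ
      F r = s ⊓ suc (D.leafRank v r)
      owned-h : ∀ u → owns v u ≡ true → h u ≡ F (rank (owns v) u)
      owned-h u ov = trans (h-leaf u (proj₁ (∧-true {leaf u} ov)))
        (cong (λ w → s ⊓ suc (D.leafRank w (rank (owns w) u))) owner≡v)
        where
        owner≡v : owner u ≡ v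
        owner≡v = ==⇒≡ (proj₂ (∧-true {leaf u} ov))
      pointwise : ∀ u → (if adj G v u then e v u else 0)
        ≡ 𝟙 (nonleaf u ∧ adj G v u) * s + (if owns v u then F (rank (owns v) u) else 0)
      pointwise u = edge-term (leaf u) (adj G v u) (nonleaf-owns v nlv u)
        (λ x y → trans e≡h (owned-h u (trans (nonleaf-owns v nlv u) (∧-intro x y))))
        (λ x → trans e≡h (h-nonleaf u x))
        where
        e≡h : e v u ≡ h u
        e≡h = trans (cong (_⊓ h u) (h-nonleaf v nlv)) (m≥n⇒m⊓n≡n (h≤s u))
        edge-term : ∀ x y {o E f} → o ≡ x ∧ y → (x ≡ true → y ≡ true → E ≡ f) → (x ≡ false → E ≡ s)
          → (if y then E else 0) ≡ 𝟙 (not x ∧ y) * s + (if o then f else 0)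
        edge-term true true refl toF _ = toF refl refl
        edge-term true false refl _ _ = refl
        edge-term false true refl _ toS = trans (toS refl) (sym (trans (+-identityʳ _) (+-identityʳ s)))
        edge-term false false refl _ _ = refl

    t : V → ℕ
    t v = c v + (k v + b v)

    deg≡t+k+σ : ∀ v → leaf v ≡ false → deg G v ≡ t v + (k v + σ v)
    deg≡t+k+σ v nlv = trans (deg≡c+l v nlv)
      (trans (cong (c v +_) (sym (D-l v))) (regroup (c v) (k v) (σ v) (b v)))
      where
      regroup : ∀ c k σ b → c + (k + (k + (σ + b))) ≡ c + (k + b) + (k + σ)
      regroup = solve-∀

    level≡2⊔t : ∀ v → leaf v ≡ false → level a v ≡ 2 ⊔ t v
    level≡2⊔t v nlv = cong (2 ⊔_) (trans (cong₂ _∸_ (deg≡t+k+σ v nlv) (half+parity (a v)))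
      (m+n∸n≡m (t v) (k v + σ v)))

    room′ : ∀ v → leaf v ≡ false → suc (k v) ≤ t v
    room′ v nlv = +-cancelʳ-≤ (k v + σ v) _ _ (subst₂ _≤_ (cong suc (sym (D-a v))) (deg≡t+k+σ v nlv) (room v nlv))

    t≥2 : ∀ v → leaf v ≡ false → deg G v ≢ 2 → 2 ≤ t v
    t≥2 v nlv d≢2 = go (t v) (k v) (σ v) (parity≤1 (a v)) (room′ v nlv)
      (subst (3 ≤_) (deg≡t+k+σ v nlv) (≤∧≢⇒< (nonleaf⇒deg≥2 v nlv) (≢-sym d≢2)))
      where
      go : ∀ t k σ → σ ≤ 1 → suc k ≤ t → 3 ≤ t + (k + σ) → 2 ≤ t
      go (suc (suc t)) _ _ _ _ _ = s≤s (s≤s z≤n)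
      go (suc zero) zero σ σ≤1 _ (s≤s 2≤σ) = contradiction (≤-trans 2≤σ σ≤1) (λ { (s≤s ()) })
      go (suc zero) (suc k) σ _ (s≤s ()) _

    deg-2 : ∀ v → leaf v ≡ false → deg G v ≡ 2 → t v + σ v ≡ 2
    deg-2 v nlv d≡2 = go (t v) (k v) (σ v) (room′ v nlv) (trans (sym (deg≡t+k+σ v nlv)) d≡2)
      where
      go : ∀ t k σ → suc k ≤ t → t + (k + σ) ≡ 2 → t + σ ≡ 2
      go t zero σ _ eq = eq
      go (suc zero) (suc k) σ (s≤s ()) eq
      go (suc (suc t)) (suc k) σ _ eq =
        contradiction (trans (sym (+-suc t (k + σ))) (suc-injective (suc-injective eq))) (λ ())

    -- A vertex with a single small leaf of edge ε accepts offsets from ε on, so it is given ε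
    -- itself; different single leaves have different ε. As ε ≥ 1, offset 0 stays free for the
    -- vertex of degree 2. All other vertices accept any offset below s and are placed afterwards.
    fixed : V → Bool
    fixed v = nonleaf v ∧ ((deg G v ≡ᵇ 2) ∨ (σ v ≡ᵇ 1))

    position : V → ℕ
    position v = if deg G v ≡ᵇ 2 then 0 else D.single v

    fixed-cases : ∀ v → fixed v ≡ true →
      (deg G v ≡ 2 × position v ≡ 0) ⊎ (deg G v ≢ 2 × σ v ≡ 1 × position v ≡ D.single v)
    fixed-cases v f with deg G v ≡ᵇ 2 in d | proj₂ (∧-true {nonleaf v} f)
    ... | true | _ = inj₁ (≡ᵇ-true⇒≡ d , refl)
    ... | false | σ≡1 = inj₂ ((λ d≡2 → contradiction (trans (sym d) (≡⇒≡ᵇ-true d≡2)) (λ ())) , ≡ᵇ-true⇒≡ σ≡1 , refl)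

    few′ : ∀ x → count (λ v → nonleaf v ∧ (level a v ≡ᵇ x)) ≤ s
    few′ x = subst (λ m → count (λ v → nonleaf v ∧ (level a v ≡ᵇ x)) ≤ suc m) (sym S≡∑a) (few x)

    open Spread s nonleaf (level a) few′

    placement : Placement fixed position
    placement .Placement.D⊆P v f = proj₁ (∧-true f)
    placement .Placement.range v f with fixed-cases v f
    ... | inj₁ (_ , eq) = subst (_< s) (sym eq) z<s
    ... | inj₂ (_ , σ≡1 , eq) = subst (_< s) (sym eq) (s≤s (D.single-≤ v σ≡1))
    placement .Placement.inj v w fv fw _ eq with fixed-cases v fv | fixed-cases w fw
    ... | inj₁ (dv , _) | inj₁ (dw , _) = one-deg-2 v w dv dw
    ... | inj₁ (_ , pv) | inj₂ (_ , _ , pw) = contradiction (trans (sym pv) (trans eq pw)) (λ ())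
    ... | inj₂ (_ , _ , pv) | inj₁ (_ , pw) = contradiction (trans (sym pw) (trans (sym eq) pv)) (λ ())
    ... | inj₂ (_ , σv , pv) | inj₂ (_ , σw , pw) =
      D.single-injective v w σv σw (trans (sym pv) (trans eq pw))

    spreading = spread fixed position placement

    final : V → ℕ
    final = proj₁ spreading

    final-< : ∀ v → nonleaf v ≡ true → final v < s
    final-< = proj₁ (proj₂ spreading)

    final-injective : ∀ v w → nonleaf v ≡ true → nonleaf w ≡ true
      → level a v ≡ level a w → final v ≡ final w → v ≡ w
    final-injective = proj₁ (proj₂ (proj₂ spreading))

    final-fixed : ∀ v → fixed v ≡ true → final v ≡ position v
    final-fixed = proj₂ (proj₂ (proj₂ spreading))

    X : V → ℕ
    X v = suc (level a v * s + final v)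

    X-range : ∀ v → leaf v ≡ false → suc (W v) ≤ X v × X v ≤ W v + s
    X-range v nlv rewrite W-nonleaf v nlv | level≡2⊔t v nlv =
      by-cases (deg G v ℕ.≟ 2) (σ v ℕ.≟ 1)
      where
      nl : nonleaf v ≡ true
      nl = cong not nlv
      Goal : ℕ → ℕ → ℕ → Set
      Goal lev σ f = suc (t v * s + σ * D.single v) ≤ suc (lev * s + f)
        × suc (lev * s + f) ≤ t v * s + σ * D.single v + s
      σ-fixed : ∀ d → σ v ≡ 1 → nonleaf v ∧ (d ∨ (σ v ≡ᵇ 1)) ≡ true
      σ-fixed true σ≡1 = ∧-intro nl refl
      σ-fixed false σ≡1 = ∧-intro nl (≡⇒≡ᵇ-true σ≡1)
      by-cases : Dec (deg G v ≡ 2) → Dec (σ v ≡ 1) → Goal (2 ⊔ t v) (σ v) (final v)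
      by-cases (yes d≡2) _ = subst (Goal (2 ⊔ t v) (σ v)) (sym final≡0)
        (window-2 s (t v) (σ v) (D.single v) (deg-2 v nlv d≡2) (parity≤1 (a v)) (s≤s z≤n)
          (λ σ≡1 → m≤n⇒m≤1+n (D.single-≤ v σ≡1)) (s≤s z≤n))
        where
        final≡0 : final v ≡ 0
        final≡0 = trans (final-fixed v (∧-intro nl (cong (_∨ (σ v ≡ᵇ 1)) (≡⇒≡ᵇ-true d≡2))))
          (cong (λ z → if z then 0 else D.single v) (≡⇒≡ᵇ-true d≡2))
      by-cases (no d≢2) (yes σ≡1) =
        subst₂ (λ τ f → Goal τ (σ v) f) (sym (m≤n⇒m⊔n≡n (t≥2 v nlv d≢2))) (sym final≡single)
          (subst (λ y → Goal (t v) y (D.single v)) (sym σ≡1)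
            (window s (t v) (1 * D.single v) (D.single v) (≤-reflexive (+-identityʳ _))
              (subst (suc (D.single v) ≤_) (cong (_+ s) (sym (+-identityʳ (D.single v))))
                (subst (_≤ D.single v + s) (+-comm _ 1) (+-monoʳ-≤ (D.single v) (s≤s z≤n))))))
        where
        final≡single : final v ≡ D.single v
        final≡single = trans (final-fixed v (σ-fixed _ σ≡1))
          (cong (λ z → if z then 0 else D.single v) (≢⇒≡ᵇ-false d≢2))
      by-cases (no d≢2) (no σ≢1) =
        subst (λ τ → Goal τ (σ v) (final v)) (sym (m≤n⇒m⊔n≡n (t≥2 v nlv d≢2)))
          (subst (λ y → Goal (t v) y (final v)) (sym σ≡0)
            (window s (t v) 0 (final v) z≤n (final-< v nl)))
        where
        σ≡0 : σ v ≡ 0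
        σ≡0 = n<1⇒n≡0 (≤∧≢⇒< (parity≤1 (a v)) σ≢1)

    weight : V → ℕ
    weight v = if leaf v then suc (suc (ρ v)) else X v

    weight-leaf : ∀ v → leaf v ≡ true → weight v ≡ suc (suc (ρ v))
    weight-leaf v lv = cong (λ x → if x then suc (suc (ρ v)) else X v) lv

    weight-nonleaf : ∀ v → leaf v ≡ false → weight v ≡ X v
    weight-nonleaf v nlv = cong (λ x → if x then suc (suc (ρ v)) else X v) nlv

    weight-range : ∀ v → suc (W v) ≤ weight v × weight v ≤ W v + s
    weight-range v = by (leaf v) refl
      where
      by : ∀ x → leaf v ≡ x → suc (W v) ≤ weight v × weight v ≤ W v + s
      by true lv = subst (λ y → suc (W v) ≤ y × y ≤ W v + s) (sym (weight-leaf v lv))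
        (s≤s (W-leaf-≤ v lv) , W-leaf-≥ v lv)
      by false nlv = subst (λ y → suc (W v) ≤ y × y ≤ W v + s) (sym (weight-nonleaf v nlv)) (X-range v nlv)

    weighting : TotalWeighting G s
    weighting .TotalWeighting.vw v = weight v ∸ W v
    weighting .TotalWeighting.ew = e
    weighting .TotalWeighting.vw-range v =
      m<n⇒0<n∸m (proj₁ (weight-range v)) , m≤n+o⇒m∸n≤o (weight v) (W v) (proj₂ (weight-range v))
    weighting .TotalWeighting.ew-range u v _ =
      ⊓-glb (1≤h u) (1≤h v) , ≤-trans (m⊓n≤m (h u) (h v)) (h≤s u)
    weighting .TotalWeighting.ew-sym u v _ = ⊓-comm (h u) (h v)

    wt≡weight : ∀ v → wt weighting v ≡ weight v
    wt≡weight v = m∸n+n≡m (<⇒≤ (proj₁ (weight-range v)))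

    -- Leaf weights are at most 2S + 2 = 2s, while every level is at least 2 and offsets start one
    -- above a multiple of s.
    leaf-below : ∀ u v → leaf u ≡ true → suc (suc (ρ u)) < X v
    leaf-below u v lu = s≤s (≤-trans (s≤s (s≤s (ρ-≤ u lu)))
      (≤-trans (≤-reflexive (twice S)) (≤-trans (*-monoˡ-≤ s (m≤m⊔n 2 (deg G v ∸ ⌈ a v /2⌉))) (m≤m+n _ _))))
      where
      twice : ∀ S → suc (suc (S + S)) ≡ 2 * suc S
      twice = solve-∀

    X-injective : ∀ u v → leaf u ≡ false → leaf v ≡ false → X u ≡ X v → u ≡ v
    X-injective u v nlu nlv eq = final-injective u v nu nv same-level
      (+-cancelˡ-≡ (level a u * s) _ _ (trans (suc-injective eq) (cong (λ x → x * s + final v) (sym same-level))))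
      where
      nu = cong not nlu
      nv = cong not nlv
      same-level : level a u ≡ level a v
      same-level = quotient-unique s (level a u) (level a v) (final-< u nu) (final-< v nv) (suc-injective eq)

    weight-injective : ∀ u v → weight u ≡ weight v → u ≡ v
    weight-injective u v eq = by (leaf u) (leaf v) refl refl
      where
      by : ∀ x y → leaf u ≡ x → leaf v ≡ y → u ≡ v
      by true true lu lv = ρ-injective u v lu lv (suc-injective (suc-injective
        (trans (sym (weight-leaf u lu)) (trans eq (weight-leaf v lv)))))
      by true false lu lv = contradiction
        (trans (sym (weight-leaf u lu)) (trans eq (weight-nonleaf v lv))) (<⇒≢ (leaf-below u v lu))
      by false true lu lv = contradiction
        (trans (sym (weight-leaf v lv)) (trans (sym eq) (weight-nonleaf u lu))) (<⇒≢ (leaf-below v u lv))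
      by false false lu lv = X-injective u v lu lv
        (trans (sym (weight-nonleaf u lu)) (trans eq (weight-nonleaf v lv)))

    irregular : Irregular weighting
    irregular u v u≢v eq = u≢v (weight-injective u v (trans (sym (wt≡weight u)) (trans eq (wt≡weight v))))

-- Bounds on the number of vertices in a window

module LowerBound (G : Graph) (no-isolated : ∀ v → deg G v ≢ 0) where

  open Leaves G no-isolated

  leaf-weights-fit : ∀ t → Fin (n G) → Σ (TotalWeighting G t) Irregular → suc ⌊ n₁ G /2⌋ ≤ t
  -- There is no label between 1 and 0, so a single vertex rules out strength 0.
  leaf-weights-fit zero v₀ (w , _) with () ← ≤-trans (proj₁ (vw-range w v₀)) (proj₂ (vw-range w v₀))
  leaf-weights-fit (suc t) v₀ (w , irr) = s≤s (begin
    -- For strength `suc t` the shifted leaf weights take at most 2t + 1 values, and the floor of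
    -- half of 2t + 1 is by definition the ceiling of half of 2t.
    ⌊ n₁ G /2⌋        ≤⟨ ⌊n/2⌋-mono (count-injection leaf (λ v → wt w v ∸ 2) (suc (t + t)) below distinct) ⟩
    ⌈ t + t /2⌉       ≡⟨ n≡⌈n+n/2⌉ t ⟨
    t                 ∎)
    where
    open ≤-Reasoning
    wt-leaf : ∀ v → leaf v ≡ true → wt w v ≡ vw w v + ew w v (nb v)
    wt-leaf v lv = cong (vw w v +_) (∑-leaf-edges v lv (ew w v))
    2≤wt : ∀ v → leaf v ≡ true → 2 ≤ wt w v
    2≤wt v lv = subst (2 ≤_) (sym (wt-leaf v lv))
      (+-mono-≤ (proj₁ (vw-range w v)) (proj₁ (ew-range w v (nb v) (nb-adj v))))
    below : ∀ v → leaf v ≡ true → wt w v ∸ 2 < suc (t + t)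
    below v lv = s≤s (∸-monoˡ-≤ 2 (subst (_≤ 2 + (t + t)) (sym (wt-leaf v lv))
      (≤-trans (+-mono-≤ (proj₂ (vw-range w v)) (proj₂ (ew-range w v (nb v) (nb-adj v))))
        (≤-reflexive (cong suc (+-suc t t))))))
    distinct : ∀ u v → leaf u ≡ true → leaf v ≡ true → wt w u ∸ 2 ≡ wt w v ∸ 2 → u ≡ v
    distinct u v lu lv eq with u ≟ v
    ... | yes u≡v = u≡v
    ... | no u≢v = contradiction (∸-cancelʳ-≡ (2≤wt u lu) (2≤wt v lv) eq) (irr u v u≢v)

-- Choosing the number of small leaves at each vertex

module Planning (G : Graph) (forest : IsForest G) (no-isolated : ∀ v → deg G v ≢ 0)
  (one-deg-2 : ∀ u v → deg G u ≡ 2 → deg G v ≡ 2 → u ≡ v) where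

  open Leaves G no-isolated
  open Construction G no-isolated one-deg-2

  S : ℕ
  S = ⌊ n₁ G /2⌋

  n₁≤1+2S : n₁ G ≤ suc (S + S)
  n₁≤1+2S = begin
    n₁ G                         ≡⟨ halves (n₁ G) ⟨
    S + (S + parity (n₁ G))      ≤⟨ +-monoʳ-≤ S (+-monoʳ-≤ S (parity≤1 (n₁ G))) ⟩
    S + (S + 1)                  ≡⟨ rearrange S ⟩
    suc (S + S)                  ∎
    where
    open ≤-Reasoning
    rearrange : ∀ S → S + (S + 1) ≡ suc (S + S)
    rearrange = solve-∀

  ∑deg≤2n : ∑ (deg G) ≤ 2 * n G
  ∑deg≤2n = forest-edges G forest (n G) (λ _ → true) (trans (∑-const {n G} 1) (*-identityʳ (n G)))

  -- The average degree of a forest is at most 2, so the summands 2 on the left absorb the degrees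
  -- on the right. This reduces each global count to an inequality at one vertex.
  discharge : ∀ (A B : V → ℕ) → (∀ v → A v + 2 ≤ deg G v + B v) → ∑ A ≤ ∑ B
  discharge A B h = lin 0 (+-mono-≤ summed ∑deg≤2n) (rearrange (∑ A) (∑ B) (n G) (∑ (deg G)))
    where
    summed : ∑ A + n G * 2 ≤ ∑ (deg G) + ∑ B
    summed = subst₂ _≤_ (trans (∑-distrib-+ A (λ _ → 2)) (cong (∑ A +_) (∑-const {n G} 2)))
      (∑-distrib-+ (deg G) B) (∑-mono h)
    rearrange : ∀ A B n d → A + (d + B + 2 * n) + 0 ≡ B + (A + n * 2 + d)
    rearrange = solve-∀

  at-level : (V → ℕ) → ℕ → V → Bool
  at-level a x v = nonleaf v ∧ (level a v ≡ᵇ x)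

  at-level⇒ : ∀ a {x v} → at-level a x v ≡ true → leaf v ≡ false × level a v ≡ x
  at-level⇒ a {x} {v} h = let (nl , lev) = ∧-true {nonleaf v} h in nonleaf⇒ {v} nl , ≡ᵇ-true⇒≡ lev

  level-zero : ∀ a v → a v ≡ 0 → leaf v ≡ false → level a v ≡ deg G v
  level-zero a v a≡0 nlv rewrite a≡0 = m≤n⇒m⊔n≡n (nonleaf⇒deg≥2 v nlv)

  count-deg-2 : count (λ v → deg G v ≡ᵇ 2) ≤ 1
  count-deg-2 = count-≤1 _ λ u v du dv → one-deg-2 u v (≡ᵇ-true⇒≡ du) (≡ᵇ-true⇒≡ dv)

  half-≤ : ∀ {m k} → 2 * m ≤ suc (k + k) → m ≤ k
  half-≤ {m} {k} h = subst₂ _≤_ (trans (cong ⌊_/2⌋ (cong (m +_) (+-identityʳ m))) (sym (n≡⌊n+n/2⌋ m)))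
    (sym (n≡⌈n+n/2⌉ k)) (⌊n/2⌋-mono h)

  -- A vertex in window 2 has a small leaf or degree 2, which allows S + 1 of them. Windows from 4
  -- on need degree at least 4, and discharging gives at most half as many such vertices as leaves.
  few-from-3 : ∀ a → ∑ a ≡ S → count (at-level a 3) ≤ suc S → ∀ x → count (at-level a x) ≤ suc (∑ a)
  few-from-3 a ∑a≡S few₃ x = subst (λ m → count (at-level a x) ≤ suc m) (sym ∑a≡S) (few x)
    where
    below-2 : ∀ {x} → x < 2 → count (at-level a x) ≤ suc S
    below-2 {x} x<2 = ≤-trans (≤-reflexive (none⇒count≡0 (at-level a x) none)) z≤n
      where
      none : ¬ (∃ λ v → at-level a x v ≡ true)
      none (v , h) = <⇒≱ x<2 (subst (2 ≤_) (proj₂ (at-level⇒ a {x} h)) (m≤m⊔n 2 (deg G v ∸ ⌈ a v /2⌉)))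
    level-2 : ∀ v → 𝟙 (at-level a 2 v) ≤ a v + 𝟙 (deg G v ≡ᵇ 2)
    level-2 v with at-level a 2 v in h
    ... | false = z≤n
    ... | true = by (a v) refl
      where
      nlv = proj₁ (at-level⇒ a {2} {v} h)
      lev = proj₂ (at-level⇒ a {2} {v} h)
      by : ∀ m → a v ≡ m → 1 ≤ a v + 𝟙 (deg G v ≡ᵇ 2)
      by zero a≡0 = ≤-trans (1≤𝟙 (≡⇒≡ᵇ-true (trans (sym (level-zero a v a≡0 nlv)) lev))) (m≤n+m _ _)
      by (suc m) a≡ = ≤-trans (subst (1 ≤_) (sym a≡) (s≤s z≤n)) (m≤m+n _ _)
    level-≥4 : ∀ x v → 2 * 𝟙 (at-level a (4 + x) v) + 2 ≤ deg G v + 𝟙 (leaf v)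
    level-≥4 x v with at-level a (4 + x) v in h
    ... | true = let (_ , lev) = at-level⇒ a {4 + x} {v} h in
      ≤-trans (deg≥4 (deg G v) (deg G v ∸ ⌈ a v /2⌉) (m∸n≤m _ ⌈ a v /2⌉) lev) (m≤m+n _ _)
      where
      deg≥4 : ∀ d y → y ≤ d → 2 ⊔ y ≡ 4 + x → 4 ≤ d
      deg≥4 d (suc (suc y)) y≤d eq = ≤-trans (subst (4 ≤_) (sym eq) (m≤m+n 4 x)) y≤d
    ... | false = by (leaf v) refl
      where
      by : ∀ b → leaf v ≡ b → 2 ≤ deg G v + 𝟙 (leaf v)
      by true lv rewrite lv | leaf⇒deg≡1 v lv = ≤-refl
      by false nlv = ≤-trans (nonleaf⇒deg≥2 v nlv) (m≤m+n _ _)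
    few : ∀ x → count (at-level a x) ≤ suc S
    few zero = below-2 (s≤s z≤n)
    few (suc zero) = below-2 (s≤s (s≤s z≤n))
    few (suc (suc zero)) = begin
      count (at-level a 2)                        ≤⟨ ∑-mono level-2 ⟩
      ∑ (λ v → a v + 𝟙 (deg G v ≡ᵇ 2))            ≡⟨ ∑-distrib-+ a _ ⟩
      ∑ a + count (λ v → deg G v ≡ᵇ 2)            ≤⟨ +-mono-≤ (≤-reflexive ∑a≡S) count-deg-2 ⟩
      S + 1                                       ≡⟨ +-comm S 1 ⟩
      suc S                                       ∎
      where open ≤-Reasoning
    few (suc (suc (suc zero))) = few₃
    few (suc (suc (suc (suc x)))) = m≤n⇒m≤1+n (half-≤ (≤-trans
      (subst (_≤ n₁ G) (∑-distribˡ-* 2 (λ v → 𝟙 (at-level a (4 + x) v))) (discharge _ _ (level-≥4 x)))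
      n₁≤1+2S))

  leafed-3 : V → Bool
  leafed-3 v = nonleaf v ∧ ((deg G v ≡ᵇ 3) ∧ (0 <ᵇ l v))

  leafed-3⇒ : ∀ v → leafed-3 v ≡ true → leaf v ≡ false × deg G v ≡ 3 × 0 < l v
  leafed-3⇒ v h with ∧-true {nonleaf v} h
  ... | nl , h′ with ∧-true {deg G v ≡ᵇ 3} h′
  ... | d , l>0 = nonleaf⇒ {v} nl , ≡ᵇ-true⇒≡ d , <ᵇ-true⇒< l>0

  leafed-3-leaf : ∀ v → leaf v ≡ true → 𝟙 (leafed-3 v) ≡ 0
  leafed-3-leaf v lv = cong (λ x → 𝟙 (not x ∧ ((deg G v ≡ᵇ 3) ∧ (0 <ᵇ l v)))) lv

  -- Here all small leaves can be spent on vertices of degree 3, one on each, so that every small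
  -- leaf takes a vertex out of window 3.
  plan-many : S ≤ count leafed-3 → ∃ λ a → Plan a × ∑ a ≡ S
  plan-many many with fill (λ _ → 0) (𝟙 ∘ leafed-3) S (λ _ → z≤n)
    (≤-trans (≤-reflexive (∑-zero {n G} (λ _ → refl))) z≤n) many
  ... | a , bounds , ∑a≡S , _ = a , plan , ∑a≡S
    where
    a≤ : ∀ v → a v ≤ 𝟙 (leafed-3 v)
    a≤ v = proj₂ (bounds v)
    a-leaf : ∀ v → leaf v ≡ true → a v ≡ 0
    a-leaf v lv = n≤0⇒n≡0 (subst (a v ≤_) (leafed-3-leaf v lv) (a≤ v))
    -- A vertex of degree 3 either stays in window 3 or has received a small leaf, never both; the
    -- sum over all vertices thus bounds the window count plus S by the number of leaves.
    level-3 : ∀ v → 𝟙 (at-level a 3 v) + a v + 2 ≤ deg G v + 𝟙 (leaf v)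
    level-3 v = by (leaf v) (a v) refl refl
      where
      Goal : ℕ → Set
      Goal x = x + a v + 2 ≤ deg G v + 𝟙 (leaf v)
      by : ∀ x m → leaf v ≡ x → a v ≡ m → Goal (𝟙 (at-level a 3 v))
      by true m lv _ rewrite lv | leaf⇒deg≡1 v lv | a-leaf v lv = ≤-refl
      by false zero nlv a≡0 = subst (λ y → 𝟙 (at-level a 3 v) + y + 2 ≤ deg G v + 𝟙 (leaf v)) (sym a≡0)
        (on (at-level a 3 v) refl)
        where
        on : ∀ y → at-level a 3 v ≡ y → 𝟙 (at-level a 3 v) + 0 + 2 ≤ deg G v + 𝟙 (leaf v)
        on true h = subst (λ y → 𝟙 y + 0 + 2 ≤ deg G v + 𝟙 (leaf v)) (sym h)
          (≤-trans (≤-reflexive (trans (sym (proj₂ (at-level⇒ a {3} {v} h))) (level-zero a v a≡0 nlv))) (m≤m+n _ _))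
        on false h = subst (λ y → 𝟙 y + 0 + 2 ≤ deg G v + 𝟙 (leaf v)) (sym h)
          (≤-trans (nonleaf⇒deg≥2 v nlv) (m≤m+n _ _))
      by false (suc m) nlv a≡ with leafed-3 v in e3 | a≤ v
      ... | false | a≤0 = contradiction (trans (sym a≡) (n≤0⇒n≡0 a≤0)) (λ ())
      ... | true | a≤1 = subst Goal (sym off)
        (≤-trans (+-monoˡ-≤ 2 a≤1) (≤-trans (≤-reflexive (sym d≡3)) (m≤m+n _ _)))
        where
        d≡3 : deg G v ≡ 3
        d≡3 = proj₁ (proj₂ (leafed-3⇒ v e3))
        a≡1 : a v ≡ 1
        a≡1 = ≤-antisym a≤1 (subst (1 ≤_) (sym a≡) (s≤s z≤n))
        off : 𝟙 (at-level a 3 v) ≡ 0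
        off = cong 𝟙 (trans (cong₂ (λ d x → nonleaf v ∧ (2 ⊔ (d ∸ ⌈ x /2⌉) ≡ᵇ 3)) d≡3 a≡1) (∧-zeroʳ _))
    few₃ : count (at-level a 3) ≤ suc S
    few₃ = lin 0 (≤-trans (discharge _ _ level-3) n₁≤1+2S)
      (trans (rearrange (count (at-level a 3)) S) (cong (suc S +_) (sym
        (trans (∑-distrib-+ (λ v → 𝟙 (at-level a 3 v)) a) (cong (count (at-level a 3) +_) ∑a≡S)))))
      where
      rearrange : ∀ x S → x + suc (S + S) + 0 ≡ suc S + (x + S)
      rearrange = solve-∀
    plan : Plan a
    plan .Plan.a≤l v = by (leafed-3 v) refl
      where
      by : ∀ x → leafed-3 v ≡ x → a v ≤ l v
      by true h = ≤-trans (a≤ v) (≤-trans (𝟙≤1 _) (proj₂ (proj₂ (leafed-3⇒ v h))))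
      by false h = ≤-trans (subst (λ x → a v ≤ 𝟙 x) h (a≤ v)) z≤n
    plan .Plan.n₁-bound = subst (λ m → n₁ G ≤ suc (m + m)) (sym ∑a≡S) n₁≤1+2S
    plan .Plan.room v nlv = ≤-trans (s≤s (≤-trans (a≤ v) (𝟙≤1 _))) (nonleaf⇒deg≥2 v nlv)
    plan .Plan.one-mixed v w lv _ a≡1 _ _ _ = contradiction (trans (sym (a-leaf v lv)) a≡1) (λ ())
    plan .Plan.few = few-from-3 a ∑a≡S few₃

  -- The limit `deg G v ∸ 1` matters only at the centre of a star, where making all leaves small
  -- would violate `room`.
  cap : V → ℕ
  cap v = if leaf v then l v else l v ⊓ (deg G v ∸ 1)

  cap-leaf : ∀ v → leaf v ≡ true → cap v ≡ l v
  cap-leaf v lv = cong (λ x → if x then l v else l v ⊓ (deg G v ∸ 1)) lv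

  cap-nonleaf : ∀ v → leaf v ≡ false → cap v ≡ l v ⊓ (deg G v ∸ 1)
  cap-nonleaf v nlv = cong (λ x → if x then l v else l v ⊓ (deg G v ∸ 1)) nlv

  cap≤l : ∀ v → cap v ≤ l v
  cap≤l v with leaf v
  ... | true = ≤-refl
  ... | false = m⊓n≤m _ _

  lo≤cap : ∀ v → 𝟙 (leafed-3 v) ≤ cap v
  lo≤cap v with leafed-3 v in h
  ... | false = z≤n
  ... | true = let (nlv , d≡3 , l>0) = leafed-3⇒ v h in
    subst (1 ≤_) (sym (cap-nonleaf v nlv)) (⊓-glb l>0 (subst (λ d → 1 ≤ d ∸ 1) (sym d≡3) (s≤s z≤n)))

  -- Guarantees that the caps can hold all S small leaves; at an inner vertex it rests on d ≤ 2 (d -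
  -- 1) for degree d ≥ 2.
  l≤2cap : ∀ v → l v ≤ 2 * cap v
  l≤2cap v = by (leaf v) refl
    where
    open ≤-Reasoning
    doubles : ∀ x → 2 ≤ x → x ≤ 2 * (x ∸ 1)
    doubles (suc (suc x)) _ = lin x (z≤n {0}) (slack x)
      where
      slack : ∀ x → suc (suc x) + 0 + x ≡ 2 * suc x + 0
      slack = solve-∀
    doubles (suc zero) (s≤s ())
    by : ∀ x → leaf v ≡ x → l v ≤ 2 * cap v
    by true lv = subst (λ x → l v ≤ 2 * x) (sym (cap-leaf v lv)) (m≤m+n (l v) _)
    by false nlv = subst (λ x → l v ≤ 2 * x) (sym (cap-nonleaf v nlv))
      (subst (l v ≤_) (sym (*-distribˡ-⊓ 2 (l v) (deg G v ∸ 1)))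
        (⊓-glb (m≤m+n (l v) _)
          (≤-trans (≤-trans (m≤n+m (l v) (c v)) (≤-reflexive (sym (deg≡c+l v nlv))))
            (doubles (deg G v) (nonleaf⇒deg≥2 v nlv)))))

  S≤∑cap : S ≤ ∑ cap
  S≤∑cap = ≤-trans (⌊n/2⌋-mono n₁≤2∑cap)
    (≤-reflexive (trans (cong ⌊_/2⌋ (cong (∑ cap +_) (+-identityʳ _))) (sym (n≡⌊n+n/2⌋ (∑ cap)))))
    where
    n₁≤2∑cap : n₁ G ≤ 2 * ∑ cap
    n₁≤2∑cap = subst₂ _≤_ ∑l≡n₁ (∑-distribˡ-* 2 cap) (∑-mono l≤2cap)

  -- The forest without its leaves, and without the star centres that become isolated by this. Such
  -- a centre would be charged 2 in the second forest bound without contributing any inner degree.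
  inner : V → Bool
  inner v = nonleaf v ∧ (0 <ᵇ c v)

  c≤inner-deg : ∀ v → inner v ≡ true → c v ≤ inner-deg G inner v
  c≤inner-deg v iv = count-mono λ u h → let (nu , vu) = ∧-true {nonleaf u} h in
    ∧-intro iv (∧-intro (∧-intro nu (<⇒<ᵇ-true (count-≥1 (λ w → nonleaf w ∧ adj G u w) v
      (∧-intro (proj₁ (∧-true {nonleaf v} iv)) (adj-sym G vu))))) vu)

  module FewLeafed (few-leafed : count leafed-3 ≤ S) where

    private
      filled = fill (𝟙 ∘ leafed-3) cap S lo≤cap few-leafed S≤∑cap

    a : V → ℕ
    a = proj₁ filled

    lo≤a : ∀ v → 𝟙 (leafed-3 v) ≤ a v
    lo≤a v = proj₁ (proj₁ (proj₂ filled) v)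

    a≤cap : ∀ v → a v ≤ cap v
    a≤cap v = proj₂ (proj₁ (proj₂ filled) v)

    ∑a≡S : ∑ a ≡ S
    ∑a≡S = proj₁ (proj₂ (proj₂ filled))

    one-partial : ∀ v w → a v ≢ 𝟙 (leafed-3 v) → a v ≢ cap v → a w ≢ 𝟙 (leafed-3 w) → a w ≢ cap w → v ≡ w
    one-partial = proj₂ (proj₂ (proj₂ filled))

    partial : V → Bool
    partial v = not (a v ≡ᵇ 𝟙 (leafed-3 v)) ∧ not (a v ≡ᵇ cap v)

    partial⇐ : ∀ v → a v ≢ 𝟙 (leafed-3 v) → a v ≢ cap v → partial v ≡ true
    partial⇐ v p q = cong₂ (λ x y → not x ∧ not y) (≢⇒≡ᵇ-false p) (≢⇒≡ᵇ-false q)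

    count-partial : count partial ≤ 1
    count-partial = count-≤1 partial λ v w hv hw → one-partial v w (not-lo v hv) (not-cap v hv) (not-lo w hw) (not-cap w hw)
      where
      not-equal : ∀ {x y} → not (x ≡ᵇ y) ≡ true → x ≢ y
      not-equal {x} {y} h eq with () ← trans (sym h) (cong not (≡⇒≡ᵇ-true eq))
      not-lo : ∀ v → partial v ≡ true → a v ≢ 𝟙 (leafed-3 v)
      not-lo v h = not-equal (proj₁ (∧-true h))
      not-cap : ∀ v → partial v ≡ true → a v ≢ cap v
      not-cap v h = not-equal (proj₂ (∧-true {not (a v ≡ᵇ 𝟙 (leafed-3 v))} h))

    -- The local form of both forest bounds together: the 2 is paid for by the degree bound,
    -- `2 * 𝟙 (inner v)` by the bound for the inner forest. The last two terms on the right each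
    -- cover one exceptional vertex. The arguments of `estimate` are lower bounds for the five terms
    -- on the right.
    level-3 : ∀ v → 2 * 𝟙 (at-level a 3 v) + 2 * 𝟙 (inner v) + 2
      ≤ deg G v + (𝟙 (leaf v) + (inner-deg G inner v + (𝟙 (partial v) + 𝟙 (deg G v ≡ᵇ 2))))
    level-3 v = by (leaf v) (at-level a 3 v) (c v) refl refl refl
      where
      Goal : Bool → Bool → Set
      Goal x y = 2 * 𝟙 x + 2 * 𝟙 y + 2
        ≤ deg G v + (𝟙 (leaf v) + (inner-deg G inner v + (𝟙 (partial v) + 𝟙 (deg G v ≡ᵇ 2))))
      estimate : ∀ {m} d x D p q → d ≤ deg G v → x ≤ 𝟙 (leaf v) → D ≤ inner-deg G inner v
        → p ≤ 𝟙 (partial v) → q ≤ 𝟙 (deg G v ≡ᵇ 2) → m ≤ d + (x + (D + (p + q)))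
        → m ≤ deg G v + (𝟙 (leaf v) + (inner-deg G inner v + (𝟙 (partial v) + 𝟙 (deg G v ≡ᵇ 2))))
      estimate _ _ _ _ _ d x D p q m = ≤-trans m (+-mono-≤ d (+-mono-≤ x (+-mono-≤ D (+-mono-≤ p q))))
      c≡0⇒ : c v ≡ 0 → inner v ≡ false
      c≡0⇒ c≡0 = trans (cong (λ z → nonleaf v ∧ (0 <ᵇ z)) c≡0) (∧-zeroʳ _)
      c>0⇒ : leaf v ≡ false → ∀ {z} → c v ≡ suc z → inner v ≡ true
      c>0⇒ nlv c≡ = cong₂ (λ x z → not x ∧ (0 <ᵇ z)) nlv c≡
      c≤D : leaf v ≡ false → ∀ {z} → c v ≡ suc z → suc z ≤ inner-deg G inner v
      c≤D nlv c≡ = subst (_≤ inner-deg G inner v) c≡ (c≤inner-deg v (c>0⇒ nlv c≡))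
      level-at : ∀ {d x} → deg G v ≡ d → a v ≡ x → level a v ≡ 2 ⊔ (d ∸ ⌈ x /2⌉)
      level-at d≡ a≡ = cong₂ (λ d x → 2 ⊔ (d ∸ ⌈ x /2⌉)) d≡ a≡
      impossible : level a v ≡ 3 → ∀ {x} {C : Set} → level a v ≡ x → x ≢ 3 → C
      impossible lev eq x≢3 = contradiction (trans (sym eq) lev) x≢3
      on-level : ∀ d z → leaf v ≡ false → level a v ≡ 3 → deg G v ≡ d → c v ≡ z → Goal true (inner v)
      on-level 0 z nlv lev d≡ c≡ = contradiction d≡ (no-isolated v)
      on-level 1 z nlv lev d≡ c≡ = contradiction (subst (2 ≤_) d≡ (nonleaf⇒deg≥2 v nlv)) λ { (s≤s ()) }
      on-level 2 z nlv lev d≡ c≡ = impossible lev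
        (trans (level-at {2} {a v} d≡ refl) (m≥n⇒m⊔n≡m (m∸n≤m 2 ⌈ a v /2⌉))) (λ ())
      -- A vertex of degree 3 with a leaf was served first and left window 3, so all three
      -- neighbours are inner and 3 + 3 pays for 6.
      on-level 3 z nlv lev d≡ c≡ = subst (Goal true) (sym (c>0⇒ nlv c≡3))
        (estimate 3 0 3 0 0 (≤-reflexive (sym d≡)) z≤n (c≤D nlv c≡3) z≤n z≤n ≤-refl)
        where
        a≡0 : ∀ x → a v ≡ x → a v ≡ 0
        a≡0 zero eq = eq
        a≡0 (suc x) eq = impossible lev
          (trans (level-at d≡ eq) (m≥n⇒m⊔n≡m (∸-monoʳ-≤ {1} {⌈ suc x /2⌉} 3 (s≤s z≤n)))) (λ ())
        l≡0 : ∀ x → l v ≡ x → l v ≡ 0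
        l≡0 zero eq = eq
        l≡0 (suc x) eq = contradiction (≤-trans (≤-reflexive (sym (cong 𝟙 is-leafed))) (lo≤a v))
          (subst (λ y → ¬ 1 ≤ y) (sym (a≡0 _ refl)) (λ ()))
          where
          is-leafed : leafed-3 v ≡ true
          is-leafed = ∧-intro (cong not nlv) (∧-intro (≡⇒≡ᵇ-true d≡) (cong (0 <ᵇ_) eq))
        c≡3 : c v ≡ 3
        c≡3 = trans (sym (+-identityʳ (c v))) (trans (cong (c v +_) (sym (l≡0 _ refl)))
          (trans (sym (deg≡c+l v nlv)) d≡))
      on-level 4 0 nlv lev d≡ c≡ = subst (Goal true) (sym (c≡0⇒ c≡))
        (estimate 4 0 0 0 0 (≤-reflexive (sym d≡)) z≤n z≤n z≤n z≤n ≤-refl)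
      -- The deficient case, 4 + 1 against 6. Window 3 needs one or two small leaves here, while the
      -- bounds of the filling are 0 and 3, so this is the one vertex that is partly filled.
      on-level 4 1 nlv lev d≡ c≡ = subst (Goal true) (sym (c>0⇒ nlv c≡))
        (estimate 4 0 1 1 0 (≤-reflexive (sym d≡)) z≤n (c≤D nlv c≡) (1≤𝟙 (partial⇐ v not-lo not-cap)) z≤n ≤-refl)
        where
        not-leafed : leafed-3 v ≡ false
        not-leafed = trans (cong (λ d → nonleaf v ∧ ((d ≡ᵇ 3) ∧ (0 <ᵇ l v))) d≡) (∧-zeroʳ _)
        l≡3 : l v ≡ 3
        l≡3 = suc-injective (trans (cong (_+ l v) (sym c≡)) (trans (sym (deg≡c+l v nlv)) d≡))
        cap≡3 : cap v ≡ 3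
        cap≡3 = trans (cap-nonleaf v nlv) (cong₂ (λ x d → x ⊓ (d ∸ 1)) l≡3 d≡)
        not-lo : a v ≢ 𝟙 (leafed-3 v)
        not-lo eq = impossible lev (level-at d≡ (trans eq (cong 𝟙 not-leafed))) (λ ())
        not-cap : a v ≢ cap v
        not-cap eq = impossible lev (level-at d≡ (trans eq cap≡3)) (λ ())
      on-level 4 (suc (suc z)) nlv lev d≡ c≡ = subst (Goal true) (sym (c>0⇒ nlv c≡))
        (estimate 4 0 2 0 0 (≤-reflexive (sym d≡)) z≤n (≤-trans (s≤s (s≤s z≤n)) (c≤D nlv c≡)) z≤n z≤n ≤-refl)
      on-level (suc (suc (suc (suc (suc d))))) zero nlv lev d≡ c≡ = subst (Goal true) (sym (c≡0⇒ c≡))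
        (estimate 4 0 0 0 0 (subst (4 ≤_) (sym d≡) (m≤m+n 4 _)) z≤n z≤n z≤n z≤n ≤-refl)
      on-level (suc (suc (suc (suc (suc d))))) (suc z) nlv lev d≡ c≡ = subst (Goal true) (sym (c>0⇒ nlv c≡))
        (estimate 5 0 1 0 0 (subst (5 ≤_) (sym d≡) (m≤m+n 5 _)) z≤n (≤-trans (s≤s z≤n) (c≤D nlv c≡)) z≤n z≤n ≤-refl)
      off-level : Dec (deg G v ≡ 2) → ∀ z → leaf v ≡ false → c v ≡ z → Goal false (inner v)
      off-level _ zero nlv c≡ = subst (Goal false) (sym (c≡0⇒ c≡))
        (estimate 2 0 0 0 0 (nonleaf⇒deg≥2 v nlv) z≤n z≤n z≤n z≤n ≤-refl)
      -- Degree 2 with an inner neighbour yields only 2 + 1 against 4; the term for degree 2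
      -- supplies the missing 1.
      off-level (yes d≡2) (suc z) nlv c≡ = subst (Goal false) (sym (c>0⇒ nlv c≡))
        (estimate 2 0 1 0 1 (≤-reflexive (sym d≡2)) z≤n (≤-trans (s≤s z≤n) (c≤D nlv c≡)) z≤n
          (1≤𝟙 (≡⇒≡ᵇ-true d≡2)) ≤-refl)
      off-level (no d≢2) (suc z) nlv c≡ = subst (Goal false) (sym (c>0⇒ nlv c≡))
        (estimate 3 0 1 0 0 (≤∧≢⇒< (nonleaf⇒deg≥2 v nlv) (≢-sym d≢2)) z≤n
          (≤-trans (s≤s z≤n) (c≤D nlv c≡)) z≤n z≤n ≤-refl)
      by : ∀ x y z → leaf v ≡ x → at-level a 3 v ≡ y → c v ≡ z → Goal (at-level a 3 v) (inner v)
      by true y z lv h c≡ = subst₂ Goal (sym (cong (λ x → not x ∧ (level a v ≡ᵇ 3)) lv))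
        (sym (cong (λ x → not x ∧ (0 <ᵇ c v)) lv))
        (estimate 1 1 0 0 0 (≤-reflexive (sym (leaf⇒deg≡1 v lv))) (1≤𝟙 lv) z≤n z≤n z≤n ≤-refl)
      by false true z nlv h c≡ = subst (λ x → Goal x (inner v)) (sym h)
        (on-level (deg G v) z nlv (proj₂ (at-level⇒ a {3} {v} h)) refl c≡)
      by false false z nlv h c≡ = subst (λ x → Goal x (inner v)) (sym h)
        (off-level (deg G v ℕ.≟ 2) z nlv c≡)

    -- The two forest bounds cancel everything but 2 · count ≤ L + 1 + 1 ≤ 2S + 3, with one unit
    -- each for the partly filled vertex and the vertex of degree 2; halving gives S + 1.
    few₃ : count (at-level a 3) ≤ suc S
    few₃ = half-≤ (lin 0 (+-mono-≤ (+-mono-≤ summed (forest-edges G forest (count inner) inner refl))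
        (+-mono-≤ n₁≤1+2S (+-mono-≤ count-partial count-deg-2)))
      (rearrange (count (at-level a 3)) (count inner) (n₁ G) (∑ (inner-deg G inner)) (count partial)
        (count (λ v → deg G v ≡ᵇ 2)) S))
      where
      summed : 2 * count (at-level a 3) + 2 * count inner
        ≤ n₁ G + (∑ (inner-deg G inner) + (count partial + count (λ v → deg G v ≡ᵇ 2)))
      summed = subst₂ _≤_
        (trans (∑-distrib-+ (λ v → 2 * 𝟙 (at-level a 3 v)) _)
          (cong₂ _+_ (∑-distribˡ-* 2 (λ v → 𝟙 (at-level a 3 v))) (∑-distribˡ-* 2 (λ v → 𝟙 (inner v)))))
        (trans (∑-distrib-+ (λ v → 𝟙 (leaf v)) _) (cong (n₁ G +_)
          (trans (∑-distrib-+ (inner-deg G inner) _) (cong (∑ (inner-deg G inner) +_)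
            (∑-distrib-+ (λ v → 𝟙 (partial v)) _)))))
        (discharge _ _ level-3)
      rearrange : ∀ x i L D p d S → 2 * x + (L + (D + (p + d)) + 2 * i + (suc (S + S) + (1 + 1))) + 0
        ≡ suc (suc S + suc S) + (2 * x + 2 * i + D + (L + (p + d)))
      rearrange = solve-∀

    plan : Plan a
    plan .Plan.a≤l v = ≤-trans (a≤cap v) (cap≤l v)
    plan .Plan.n₁-bound = subst (λ m → n₁ G ≤ suc (m + m)) (sym ∑a≡S) n₁≤1+2S
    plan .Plan.room v nlv = ≤-trans
      (s≤s (≤-trans (subst (a v ≤_) (cap-nonleaf v nlv) (a≤cap v)) (m⊓n≤n _ _)))
      (≤-reflexive (m+[n∸m]≡n (≤-trans (s≤s z≤n) (nonleaf⇒deg≥2 v nlv))))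
    plan .Plan.one-mixed v w lv lw av aw v< w< = one-partial v w (not-lo v lv av) (not-cap v lv v<) (not-lo w lw aw) (not-cap w lw w<)
      where
      not-lo : ∀ v → leaf v ≡ true → a v ≡ 1 → a v ≢ 𝟙 (leafed-3 v)
      not-lo v lv a≡1 eq = contradiction (trans (sym a≡1) (trans eq (leafed-3-leaf v lv))) (λ ())
      not-cap : ∀ v → leaf v ≡ true → a v < l v → a v ≢ cap v
      not-cap v lv a<l eq = <⇒≢ a<l (trans eq (cap-leaf v lv))
    plan .Plan.few = few-from-3 a ∑a≡S few₃

  planning : ∃ λ a → Plan a × ∑ a ≡ S
  planning with ≤-total S (count leafed-3)
  ... | inj₁ many = plan-many many
  ... | inj₂ few = FewLeafed.a few , FewLeafed.plan few , FewLeafed.∑a≡S few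

theorem2 : (G : Graph) → 1 ≤ n G → IsForest G
    → (∀ v → deg G v ≢ 0)
    → (∀ u v → deg G u ≡ 2 → deg G v ≡ 2 → u ≡ v)
    → TvsIs G ⌈ n₁ G + 1 /2⌉
theorem2 G 1≤n forest no-isolated one-deg-2 rewrite +-comm (n₁ G) 1 =
  -- After the rewrite the claimed value reduces to `suc ⌊ n₁ G /2⌋`, the form in which both bounds
  -- are proved.
  subst (λ t → Σ (TotalWeighting G t) Irregular) s≡ (weighting , irregular) ,
  λ t → LowerBound.leaf-weights-fit G no-isolated t (fromℕ< 1≤n)
  where
  open Planning G forest no-isolated one-deg-2
  open Construction.Weighting G no-isolated one-deg-2 (proj₁ planning) (proj₁ (proj₂ planning))
    using (weighting; irregular; S≡∑a)
  s≡ = cong suc (trans S≡∑a (proj₂ (proj₂ planning)))
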